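{- Let $m,n$ be positive integers and $f\in L^1(\mathbb{T})$ with Fourier coefficients $d(k)$, $k\in\mathbb{Z}$. Then $$D^{[4m]}_n(f)=\mathrm{Pf}^{[2m]}\Big(\prod_{s=1}^m(i_{2s}-i_{2s-1})\cdot d\big((2n+1)m-i_1-i_2-\cdots-i_{2m}\big)\Big)_{1\le i_1,\dots,i_{2m}\le 2n}.$$ In particular $D^{[4]}_n(f)=\mathrm{pf}\big((j-i)\,d(2n+1-i-j)\big)_{1\le i,j\le 2n}$.
   Context: $\mathbb{T}$ is the unit circle with normalized Haar measure, $d(k)=\int_{\mathbb{T}}f(z)z^{ -k}\mathrm{d}z$. Toeplitz hyperdeterminant: $D^{[2p]}_n(f)=\mathrm{Det}^{[2p]}\big(d(i_1+\cdots+i_p-i_{p+1}-\cdots-i_{2p})\big)_{1\le i_1,\dots,i_{2p}\le n}$, with $\mathrm{Det}^{[2p]}(A):=\frac{1}{n!}\sum_{\sigma_1,\dots,\sigma_{2p}\in\mathfrak{S}_n}\prod_j\mathrm{sgn}(\sigma_j)\prod_{i=1}^nA(\sigma_1(i),\dots,\sigma_{2p}(i))$. Hyperpfaffian of an array $B$ indexed by $\{1,\dots,2n\}^{2m}$ that changes sign when $i_{2s-1},i_{2s}$ are interchanged (each $s$): with $\mathfrak{E}_{2n}=\{\sigma\in\mathfrak{S}_{2n}:\sigma(2i-1)<\sigma(2i)\}$, $\mathrm{Pf}^{[2m]}(B):=\frac{1}{n!}\sum_{\sigma_1,\dots,\sigma_m\in\mathfrak{E}_{2n}}\prod_s\mathrm{sgn}(\sigma_s)\prod_{i=1}^nB(\sigma_1(2i-1),\sigma_1(2i),\dots,\sigma_m(2i-1),\sigma_m(2i))$;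 $\mathrm{pf}$ is the ordinary Pfaffian. -}

module Defs where

open import Algebra.Bundles using (CommutativeRing)
open import Algebra.Module.Bundles using (Module)
import Algebra.Module.Construct.TensorUnit as TensorUnit
open import Algebra.Module.Morphism.Structures using (module ModuleMorphisms)
import Algebra.Properties.CommutativeMonoid.Sum as CommutativeMonoidSum
import Algebra.Properties.Semiring.Exp as SemiringExp
import Algebra.Properties.Semiring.Mult as SemiringMult
open import Data.Fin.Base using (Fin; toℕ; combine; punchIn; _<_)
open import Data.Fin.Patterns using (0F; 1F)
open import Data.Fin.Permutation as Perm using (Permutation′; _⟨$⟩ʳ_; insert; remove; insert-remove; remove-insert)
open import Data.Fin.Properties using (_<?_; all?; punchIn-injective)
open import Data.Integer.Base as ℤ using (ℤ; +_; -[1+_]; 0ℤ)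
open import Data.List.Base as List using (List; []; _∷_; allFin; cartesianProduct; cartesianProductWith; filter)
open import Data.List.Membership.Propositional.Properties using (∈-allFin)
import Data.List.Membership.Setoid as SetoidMembership
import Data.List.Membership.Setoid.Properties as SetoidMembershipₚ
import Data.List.Relation.Unary.All as All
import Data.List.Relation.Unary.AllPairs as AllPairs
open import Data.List.Relation.Unary.Any using (here)
import Data.List.Relation.Unary.Unique.Propositional.Properties as Uniqueₚ
import Data.List.Relation.Unary.Unique.Setoid as SetoidUnique
import Data.List.Relation.Unary.Unique.Setoid.Properties as SetoidUniqueₚ
open import Data.Nat.Base as ℕ using (ℕ; zero; suc; NonZero; _!)
open import Data.Nat.Properties using (m*n≢0; m^n≢0; _!≢0)
open import Data.Product.Base using (_×_; _,_)
open import Data.Vec.Base as Vec using (Vec; []; _∷_; lookup; take; drop)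
open import Function.Base using (_∘_)
open import Level using (Level; 0ℓ; _⊔_) renaming (suc to lsuc)
open import Relation.Binary.Bundles using (Setoid)
open import Relation.Binary.PropositionalEquality using (_≡_; _≢_; refl; sym; trans; cong; setoid)
open import Relation.Nullary.Decidable using (_×-dec_)
open import Relation.Unary using (Pred; Decidable)

private
  variable
    k n : ℕ

-- An element of Fin n stands for an index in {1, …, n}; this is that index.
idx : Fin n → ℤ
idx i = + suc (toℕ i)

∑idx : Vec (Fin n) k → ℤ
∑idx = Vec.foldr′ ℤ._+_ 0ℤ ∘ Vec.map idx

-- The one-based positions 2s−1 and 2s of {1, …, 2n}, for 1 ≤ s ≤ n.
odd even : Fin n → Fin (n ℕ.* 2)
odd  s = combine s 0F
even s = combine s 1F

-- Each permutation of {1, …, n+1} is determined by the image of 1 and by the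
-- permutation induced on the remaining points.
perms : ∀ n → List (Permutation′ n)
perms zero      = Perm.id ∷ []
perms (suc n) = cartesianProductWith (insert 0F) (allFin (suc n)) (perms n)

permSetoid : ℕ → Setoid 0ℓ 0ℓ
permSetoid n = record
  { Carrier       = Permutation′ n
  ; _≈_           = Perm._≈_
  ; isEquivalence = record
    { refl  = λ _ → refl
    ; sym   = λ p i → sym (p i)
    ; trans = λ p q i → trans (p i) (q i)
    }
  }

private
  insert-cong : ∀ {i j : Fin (suc n)} {π ρ : Permutation′ n} →
                i ≡ j → π Perm.≈ ρ → insert 0F i π Perm.≈ insert 0F j ρ
  insert-cong refl p Fin.zero    = refl
  insert-cong {i = i} refl p (Fin.suc k) = cong (punchIn i) (p k)

  remove-cong : ∀ {π ρ : Permutation′ (suc n)} →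
                π Perm.≈ ρ → remove 0F π Perm.≈ remove 0F ρ
  remove-cong {π = π} {ρ} p k = punchIn-injective (π ⟨$⟩ʳ 0F) _ _
    (trans (sym (Perm.punchIn-permute π 0F k))
    (trans (p (punchIn 0F k))
    (trans (Perm.punchIn-permute ρ 0F k)
           (cong (λ j → punchIn j (remove 0F ρ ⟨$⟩ʳ k)) (sym (p 0F))))))

  insert-injective : ∀ {i j : Fin (suc n)} {π ρ : Permutation′ n} →
                     insert 0F i π Perm.≈ insert 0F j ρ → i ≡ j × π Perm.≈ ρ
  insert-injective {i = i} {j} {π} {ρ} p = p 0F , λ k →
    trans (sym (remove-insert 0F i π k))
    (trans (remove-cong {π = insert 0F i π} {insert 0F j ρ} p k)
           (remove-insert 0F j ρ k))

perms-complete : ∀ n (π : Permutation′ n) → let open SetoidMembership (permSetoid n) in π ∈ perms n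
perms-complete zero      π = here λ ()
perms-complete (suc n) π = SetoidMembershipₚ.∈-resp-≈ S {x = insert 0F (π ⟨$⟩ʳ 0F) (remove 0F π)} {y = π}
  (insert-remove 0F π)
  (SetoidMembershipₚ.∈-cartesianProductWith⁺ (setoid _) (permSetoid n) S
    (λ {_} {_} {π} {ρ} → insert-cong {π = π} {ρ})
    (∈-allFin _) (perms-complete n (remove 0F π)))
  where S = permSetoid (suc n)

perms-unique : ∀ n → let open SetoidUnique (permSetoid n) in Unique (perms n)
perms-unique zero      = All.[] AllPairs.∷ AllPairs.[]
perms-unique (suc n) = SetoidUniqueₚ.cartesianProductWith⁺
  (setoid _) (permSetoid n) (permSetoid (suc n)) (insert 0F)
  (λ {_} {_} {π} {ρ} → insert-injective {π = π} {ρ})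
  (Uniqueₚ.allFin⁺ _) (perms-unique n)

inversions : Permutation′ n → ℕ
inversions {n} σ = List.length (filter inverted? (cartesianProduct (allFin n) (allFin n)))
  where
  inverted? : Decidable (λ ((i , j) : Fin n × Fin n) → i < j × σ ⟨$⟩ʳ j < σ ⟨$⟩ʳ i)
  inverted? (i , j) = (i <? j) ×-dec (σ ⟨$⟩ʳ j <? σ ⟨$⟩ʳ i)

PairIncreasing : ∀ n → Pred (Permutation′ (n ℕ.* 2)) 0ℓ
PairIncreasing n σ = ∀ (i : Fin n) → σ ⟨$⟩ʳ odd i < σ ⟨$⟩ʳ even i

pairIncreasing? : ∀ n → Decidable (PairIncreasing n)
pairIncreasing? n σ = all? λ i → σ ⟨$⟩ʳ odd i <? σ ⟨$⟩ʳ even i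

-- The set 𝔈₂ₙ.
𝔈 : ∀ n → List (Permutation′ (n ℕ.* 2))
𝔈 n = filter (pairIncreasing? n) (perms (n ℕ.* 2))

-- All k-tuples of entries of a list.
tuples : ∀ {a} {A : Set a} k → List A → List (Vec A k)
tuples zero      xs = [] ∷ []
tuples (suc k) xs = cartesianProductWith _∷_ xs (tuples k xs)

-- The scalars: a commutative ring in which every positive integer is
-- invertible. The field of complex numbers is the intended instance.
record Scalars c ℓ : Set (lsuc (c ⊔ ℓ)) where
  field
    commutativeRing : CommutativeRing c ℓ
  open CommutativeRing commutativeRing public
  open SemiringMult semiring public using () renaming (_×_ to _·_)
  field
    recip         : ∀ k .{{_ : NonZero k}} → Carrier
    recip-inverse : ∀ k .{{_ : NonZero k}} → (k · 1#) * recip k ≈ 1#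

  ι : ℤ → Carrier
  ι (+ k)    = k · 1#
  ι -[1+ k ] = - (suc k · 1#)

-- The structure of L¹(𝕋) through which Fourier coefficients are defined:
-- multiplication by the characters zᵏ, and integration against normalized
-- Haar measure. Elements of the module are integrable functions up to
-- almost-everywhere equality.
record L¹-Structure {c ℓ} (𝕂 : Scalars c ℓ) a b : Set (c ⊔ ℓ ⊔ lsuc (a ⊔ b)) where
  open Scalars 𝕂
  field
    functions : Module commutativeRing a b
  open Module functions public
    using (_≈ᴹ_; rawModule) renaming (Carrierᴹ to L¹)
  private
    scalars : Module commutativeRing c ℓ
    scalars = TensorUnit.⟨module⟩
  field
    one       : L¹
    z^_∙_     : ℤ → L¹ → L¹
    ∫         : L¹ → Carrier
    z^-linear : ∀ k → ModuleMorphisms.IsModuleHomomorphism rawModule rawModule (z^ k ∙_)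
    z^-zero   : ∀ f → z^ 0ℤ ∙ f ≈ᴹ f
    z^-add    : ∀ j k f → z^ (j ℤ.+ k) ∙ f ≈ᴹ z^ j ∙ (z^ k ∙ f)
    ∫-linear  : ModuleMorphisms.IsModuleHomomorphism rawModule (Module.rawModule scalars) ∫
    ∫-one     : ∫ one ≈ 1#
    ∫-z^      : ∀ k → k ≢ 0ℤ → ∫ (z^ k ∙ one) ≈ 0#

  -- k ↦ ∫ f(z) z⁻ᵏ dz
  fourier : L¹ → ℤ → Carrier
  fourier f k = ∫ (z^ (ℤ.- k) ∙ f)


module Hyper {c ℓ} (𝕂 : Scalars c ℓ) where
  open Scalars 𝕂
  open SemiringExp semiring using (_^_)
  open CommutativeMonoidSum *-commutativeMonoid public using () renaming (sum to ∏)

  ∑ : ∀ {a} {A : Set a} → List A → (A → Carrier) → Carrier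
  ∑ xs f = List.foldr (λ x s → f x + s) 0# xs

  sgn : Permutation′ n → Carrier
  sgn σ = (- 1#) ^ inversions σ

  1/_! : ℕ → Carrier
  1/ n ! = recip (n !) {{n !≢0}}

  -- The hyperdeterminant Det^[2p] of an array indexed by {1, …, n}²ᵖ.
  Det : ∀ p n → (Vec (Fin n) (2 ℕ.* p) → Carrier) → Carrier
  Det p n A = 1/ n ! * ∑ (tuples (2 ℕ.* p) (perms n)) λ σ →
    ∏ (λ j → sgn (lookup σ j)) * ∏ {n} (λ i → A (Vec.map (_⟨$⟩ʳ i) σ))

  -- The Toeplitz hyperdeterminant D^[2p]_n, as a function of the Fourier
  -- coefficients.
  D : ∀ p n → (ℤ → Carrier) → Carrier
  D p n d = Det p n λ i → d (∑idx (take p i) ℤ.- ∑idx (drop p i))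

  -- The hyperpfaffian Pf^[2m] of an array indexed by {1, …, 2n}²ᵐ; the formula
  -- makes sense whether or not the array is alternating.
  Pf : ∀ m n → (Vec (Fin (n ℕ.* 2)) (m ℕ.* 2) → Carrier) → Carrier
  Pf m n B = 1/ n ! * ∑ (tuples m (𝔈 n)) λ σ →
    ∏ (λ s → sgn (lookup σ s)) *
    ∏ {n} (λ i → B (Vec.concat (Vec.map (λ τ → (τ ⟨$⟩ʳ odd i) ∷ (τ ⟨$⟩ʳ even i) ∷ []) σ)))

  -- The ordinary Pfaffian, normalized by 1/(2ⁿ n!) because the sum is over all
  -- of 𝔖₂ₙ.
  pf : ∀ n → (Fin (n ℕ.* 2) → Fin (n ℕ.* 2) → Carrier) → Carrier
  pf n A = recip (2 ℕ.^ n ℕ.* n !) {{m*n≢0 (2 ℕ.^ n) (n !) {{m^n≢0 2 n}} {{n !≢0}}}} *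
    ∑ (perms (n ℕ.* 2)) λ σ →
      sgn σ * ∏ {n} (λ i → A (σ ⟨$⟩ʳ odd i) (σ ⟨$⟩ʳ even i))

{-# OPTIONS --safe #-}
-- Both sides are values of the linear functional zᵏ ↦ ∏ d(kᵢ) on Laurent
-- polynomials in z₁, …, zₙ: with V(z) = Σ sgn(σ) ∏ zᵢ^σ(i), the left side comes
-- from (V(z)² V(z⁻¹)²)ᵐ and the right side from Pᵐ, where P is the sum over 𝔈₂ₙ of
-- sgn(σ) ∏ (σ(2i) − σ(2i−1)) zᵢ^(2n+1−σ(2i−1)−σ(2i)). So it suffices that
-- V(z)² V(z⁻¹)² = P. With w = z⁻¹, an antisymmetrization in each pair of columns
-- turns P, up to a monomial, into the confluent Vandermonde determinant with rows
-- (wᵢᵏ)ₖ and (k wᵢᵏ)ₖ, which is ∏ wᵢ times the fourth power of the Vandermonde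
-- determinant of w; and V(z)² and V(w)² differ only by a monomial.
module Submission where

open import Defs
open import Data.Nat.Base as ℕ using (ℕ; zero; suc; NonZero; _!)
open import Data.Integer.Base as ℤ using (ℤ; +_; -[1+_]; 0ℤ; _⊖_)
open import Data.Vec.Base as Vec using (Vec; []; _∷_; _++_; lookup; take; drop)
open import Data.Product.Base using (Σ; _×_; _,_)
open import Algebra.Bundles using (CommutativeMonoid; CommutativeRing)
import Algebra.Construct.Pointwise as Pointwise
import Algebra.Properties.AbelianGroup as AbelianGroupProperties
import Algebra.Properties.CommutativeMonoid.Sum as CommutativeMonoidSum
import Algebra.Properties.CommutativeSemiring.Exp as Exp
import Algebra.Properties.Ring as RingProperties
import Algebra.Properties.Semiring.Mult as Mult
import Algebra.Properties.Semiring.Sum as SemiringSum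
import Algebra.Solver.Ring as RingSolver
open import Algebra.Solver.Ring.AlmostCommutativeRing using (fromCommutativeRing; _-Raw-AlmostCommutative⟶_)
open import Data.Bool.Base using (Bool; true; false; if_then_else_; _∧_)
open import Data.Empty using (⊥-elim)
open import Data.Fin.Base using (Fin; zero; suc; toℕ; inject₁; fromℕ<; punchIn; punchOut; pinch)
open import Data.Fin.Permutation using (Permutation′; _⟨$⟩ʳ_; insert)
open import Data.Fin.Properties using (_≟_; _<?_; <-cmp; ¬∀⟶∃¬; punchIn-injective; punchInᵢ≢i; punchIn-punchOut; toℕ-inject₁; toℕ-injective; toℕ-fromℕ<; toℕ<n; suc-injective)
import Data.Integer.Properties as ℤₚ
open import Data.Integer.Solver using (module +-*-Solver)
open import Data.List.Base as List using (List; []; _∷_; allFin; cartesianProduct; cartesianProductWith; filter; foldr; length; tabulate)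
open import Data.Maybe.Base using (just; nothing)
import Data.Nat.Properties as ℕₚ
import Data.Vec.Functional as F
open import Function.Base using (_∘_; const; id)
open import Level using (Level; _⊔_)
open import Relation.Binary.Definitions using (WeaklyDecidable; tri<; tri≈; tri>)
open import Relation.Binary.PropositionalEquality as ≡ using (_≡_; _≢_; _≗_)
import Relation.Binary.Reasoning.Setoid as SetoidReasoning
open import Relation.Binary.Structures using (IsEquivalence)
open import Relation.Nullary using (Dec; yes; no; does)
open import Relation.Nullary.Decidable using (dec-true; dec-false)
open import Relation.Unary using (Pred; Decidable)

-- Since `perms` is built by inserting the image of the first point, a signed sum over it unfolds
-- into exactly such expansions, and exchanging σ(2i-1) with σ(2i) becomes a relabeling of two
-- deleted columns.
--
-- The obstacle on the right side is the factor σ(2i) - σ(2i-1), which is not a product of one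
-- factor per column. But (b - a) w^a w^b is what remains of w^a · (b w^b) after subtracting the
-- term with a and b exchanged, and this is a power row times its Euler derivative. Each variable
-- then owns two rows, so in the resulting Vandermonde product each point counts twice and each
-- difference occurs 2 · 2 times: hence the fourth power.
--
-- The weight ∏ d(kᵢ) need not be multiplicative, so it is applied only after all identities have
-- been established between Laurent polynomials.

private
  variable
    N n : ℕ
    α ρ : Level
    X Y XY : Set α

-- Integers in a commutative ring, and a ring solver with integer coefficients

module IntegerCoefficients {c ℓ} (R : CommutativeRing c ℓ) where
  open CommutativeRing R
  open Mult semiring renaming (_×_ to _·_; ×-homo-+ to ·-homo-+)
  open RingProperties ring using (-‿distribˡ-*)
  open AbelianGroupProperties +-abelianGroup using (⁻¹-∙-comm; ε⁻¹≈ε; ⁻¹-involutive)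
  open SetoidReasoning setoid

  fromℤ : ℤ → Carrier
  fromℤ (+ k)    = k · 1#
  fromℤ -[1+ k ] = - (suc k · 1#)

  private
    cancel-1# : ∀ x y → (1# + x) - (1# + y) ≈ x - y
    cancel-1# x y = begin
      (1# + x) - (1# + y)     ≈⟨ +-congˡ (⁻¹-∙-comm 1# y) ⟨
      (1# + x) + (- 1# - y)   ≈⟨ +-congʳ (+-comm 1# x) ⟩
      (x + 1#) + (- 1# - y)   ≈⟨ +-assoc x 1# _ ⟩
      x + (1# + (- 1# - y))   ≈⟨ +-congˡ (+-assoc 1# (- 1#) (- y)) ⟨
      x + ((1# - 1#) - y)     ≈⟨ +-congˡ (+-congʳ (-‿inverseʳ 1#)) ⟩
      x + (0# - y)            ≈⟨ +-congˡ (+-identityˡ (- y)) ⟩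
      x - y                   ∎

  fromℤ-⊖ : ∀ a b → fromℤ (a ⊖ b) ≈ a · 1# - b · 1#
  fromℤ-⊖ zero    zero    = sym (-‿inverseʳ 0#)
  fromℤ-⊖ zero    (suc b) = sym (+-identityˡ _)
  fromℤ-⊖ (suc a) zero    = sym (trans (+-congˡ ε⁻¹≈ε) (+-identityʳ _))
  fromℤ-⊖ (suc a) (suc b) = begin
    fromℤ (suc a ⊖ suc b)        ≡⟨ ≡.cong fromℤ (ℤₚ.[1+m]⊖[1+n]≡m⊖n a b) ⟩
    fromℤ (a ⊖ b)                ≈⟨ fromℤ-⊖ a b ⟩
    a · 1# - b · 1#              ≈⟨ cancel-1# _ _ ⟨
    suc a · 1# - suc b · 1#      ∎

  fromℤ-+ : ∀ i j → fromℤ (i ℤ.+ j) ≈ fromℤ i + fromℤ j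
  fromℤ-+ (+ a)    (+ b)    = ·-homo-+ 1# a b
  fromℤ-+ (+ a)    -[1+ b ] = fromℤ-⊖ a (suc b)
  fromℤ-+ -[1+ a ] (+ b)    = trans (fromℤ-⊖ b (suc a)) (+-comm _ _)
  fromℤ-+ -[1+ a ] -[1+ b ] = begin
    - (suc (suc (a ℕ.+ b)) · 1#)        ≡⟨ ≡.cong (λ k → - (suc k · 1#)) (≡.sym (ℕₚ.+-suc a b)) ⟩
    - ((suc a ℕ.+ suc b) · 1#)          ≈⟨ -‿cong (·-homo-+ 1# (suc a) (suc b)) ⟩
    - (suc a · 1# + suc b · 1#)         ≈⟨ ⁻¹-∙-comm _ _ ⟨
    - (suc a · 1#) - suc b · 1#         ∎

  fromℤ-neg : ∀ i → fromℤ (ℤ.- i) ≈ - fromℤ i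
  fromℤ-neg (+ zero)  = sym ε⁻¹≈ε
  fromℤ-neg (+ suc a) = refl
  fromℤ-neg -[1+ a ]  = sym (⁻¹-involutive _)

  private
    fromℤ-*⁺ : ∀ a j → fromℤ (+ a ℤ.* j) ≈ fromℤ (+ a) * fromℤ j
    fromℤ-*⁺ zero    j = sym (zeroˡ _)
    fromℤ-*⁺ (suc a) j = begin
      fromℤ (+ suc a ℤ.* j)             ≡⟨ ≡.cong fromℤ (ℤₚ.suc-* (+ a) j) ⟩
      fromℤ (j ℤ.+ + a ℤ.* j)           ≈⟨ fromℤ-+ j (+ a ℤ.* j) ⟩
      fromℤ j + fromℤ (+ a ℤ.* j)       ≈⟨ +-cong (sym (*-identityˡ _)) (fromℤ-*⁺ a j) ⟩
      1# * fromℤ j + a · 1# * fromℤ j   ≈⟨ distribʳ _ _ _ ⟨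
      (1# + a · 1#) * fromℤ j           ∎

  fromℤ-* : ∀ i j → fromℤ (i ℤ.* j) ≈ fromℤ i * fromℤ j
  fromℤ-* (+ a)    j = fromℤ-*⁺ a j
  fromℤ-* -[1+ a ] j = begin
    fromℤ (ℤ.- (+ suc a) ℤ.* j)     ≡⟨ ≡.cong fromℤ (≡.sym (ℤₚ.neg-distribˡ-* (+ suc a) j)) ⟩
    fromℤ (ℤ.- (+ suc a ℤ.* j))     ≈⟨ fromℤ-neg (+ suc a ℤ.* j) ⟩
    - fromℤ (+ suc a ℤ.* j)         ≈⟨ -‿cong (fromℤ-*⁺ (suc a) j) ⟩
    - (suc a · 1# * fromℤ j)        ≈⟨ -‿distribˡ-* _ _ ⟩
    - (suc a · 1#) * fromℤ j        ∎

  private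
    homomorphism : ℤ.+-*-rawRing -Raw-AlmostCommutative⟶ fromCommutativeRing R
    homomorphism = record
      { ⟦_⟧    = fromℤ
      ; +-homo = fromℤ-+
      ; *-homo = fromℤ-*
      ; -‿homo = fromℤ-neg
      ; 0-homo = refl
      ; 1-homo = +-identityʳ 1#
      }

    -- The solver must recognize that coefficients such as 1 - 1 vanish. Equality in the ring is not
    -- decidable, so coefficients are normalized in ℤ. The answer `nothing` claims no difference:
    -- distinct integers may have equal images.
    fromℤ-≟ : WeaklyDecidable (λ i j → fromℤ i ≈ fromℤ j)
    fromℤ-≟ i j with i ℤₚ.≟ j
    ... | yes i≡j = just (reflexive (≡.cong fromℤ i≡j))
    ... | no  _   = nothing

  open RingSolver ℤ.+-*-rawRing (fromCommutativeRing R) homomorphism fromℤ-≟ public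
    using (solve; _:=_; _:+_; _:*_; _:-_; :-_; con; _:^_)

-- Deleting and exchanging points of finite ordinals

punchIn-inject₁-self : (k : Fin N) → punchIn (inject₁ k) k ≡ suc k
punchIn-inject₁-self zero    = ≡.refl
punchIn-inject₁-self (suc k) = ≡.cong suc (punchIn-inject₁-self k)

punchIn-suc-self : (k : Fin N) → punchIn (suc k) k ≡ inject₁ k
punchIn-suc-self zero    = ≡.refl
punchIn-suc-self (suc k) = ≡.cong suc (punchIn-suc-self k)

punchIn-inject₁-suc : (k m : Fin N) → m ≢ k → punchIn (inject₁ k) m ≡ punchIn (suc k) m
punchIn-inject₁-suc zero    zero    m≢k = ⊥-elim (m≢k ≡.refl)
punchIn-inject₁-suc zero    (suc m) m≢k = ≡.refl
punchIn-inject₁-suc (suc k) zero    m≢k = ≡.refl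
punchIn-inject₁-suc (suc k) (suc m) m≢k = ≡.cong suc (punchIn-inject₁-suc k m (m≢k ∘ ≡.cong suc))

-- Deleting a point outside an adjacent pair leaves the pair adjacent; `k′` is its new place. This
-- lets a column operation pass to the minors that contain both columns.
punchIn-adjacent : (k : Fin (suc N)) (l : Fin (suc (suc N))) → l ≢ inject₁ k → l ≢ suc k →
                   Σ (Fin N) λ k′ → punchIn l (inject₁ k′) ≡ inject₁ k × punchIn l (suc k′) ≡ suc k
punchIn-adjacent zero            zero                l≢k _    = ⊥-elim (l≢k ≡.refl)
punchIn-adjacent zero            (suc zero)          _   l≢sk = ⊥-elim (l≢sk ≡.refl)
punchIn-adjacent {suc N} zero    (suc (suc l))       _   _    = zero , ≡.refl , ≡.refl
punchIn-adjacent {suc N} (suc k) zero                _   _    = k , ≡.refl , ≡.refl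
punchIn-adjacent {suc N} (suc k) (suc l) l≢k l≢sk
  with k′ , p , q ← punchIn-adjacent k l (l≢k ∘ ≡.cong suc) (l≢sk ∘ ≡.cong suc)
  = suc k′ , ≡.cong suc p , ≡.cong suc q

-- (j , k) ↦ (punchIn j k , pinch k j) exchanges the two elements of the ordered
-- pair of distinct elements (j , punchIn j k).
punchIn-pinch : (j : Fin (suc N)) (k : Fin N) → punchIn (punchIn j k) (pinch k j) ≡ j
punchIn-pinch zero    zero    = ≡.refl
punchIn-pinch zero    (suc k) = ≡.refl
punchIn-pinch (suc j) zero    = ≡.refl
punchIn-pinch (suc j) (suc k) = ≡.cong suc (punchIn-pinch j k)

-- Both sides list in increasing order the points other than `j` and `punchIn j k`; the order in
-- which these two are removed does not matter.
punchIn-punchIn-pinch : (j : Fin (suc (suc N))) (k : Fin (suc N)) (l : Fin N) →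
  punchIn (punchIn j k) (punchIn (pinch k j) l) ≡ punchIn j (punchIn k l)
punchIn-punchIn-pinch zero    zero    l       = ≡.refl
punchIn-punchIn-pinch zero    (suc k) l       = ≡.refl
punchIn-punchIn-pinch (suc j) zero    l       = ≡.refl
punchIn-punchIn-pinch (suc j) (suc k) zero    = ≡.refl
punchIn-punchIn-pinch (suc j) (suc k) (suc l) = ≡.cong suc (punchIn-punchIn-pinch j k l)

-- The recursion follows `suc n ℕ.* 2`, which computes to two successors over `n ℕ.* 2`, so removing
-- the first two rows of an interleaved matrix leaves an interleaved matrix.
interleave : ∀ {a} {X : Set a} → (Fin n → X) → (Fin n → X) → Fin (n ℕ.* 2) → X
interleave {n = suc n} f g zero          = f zero
interleave {n = suc n} f g (suc zero)    = g zero
interleave {n = suc n} f g (suc (suc r)) = interleave (f ∘ suc) (g ∘ suc) r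

interleave-map : ∀ {a b} {X : Set a} {Y : Set b} (h : X → Y) (f g : Fin n → X) →
                 interleave (h ∘ f) (h ∘ g) ≗ h ∘ interleave f g
interleave-map {n = suc n} h f g zero          = ≡.refl
interleave-map {n = suc n} h f g (suc zero)    = ≡.refl
interleave-map {n = suc n} h f g (suc (suc r)) = interleave-map h (f ∘ suc) (g ∘ suc) r

-- Determinants and column operations

module Determinants {c ℓ} (R : CommutativeRing c ℓ) where
  open CommutativeRing R hiding (zero)
  open IntegerCoefficients R using (solve; _:=_; _:+_; _:*_; _:-_; :-_; con)
  open Exp commutativeSemiring using (_^_; ^-congˡ; ^-distrib-*)
  open SemiringSum semiring using (sum; sum-cong-≋; *-distribˡ-sum; ∑-distrib-+; sum-replicate-zero)
  open CommutativeMonoidSum *-commutativeMonoid using ()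
    renaming (sum to ∏)
  open Mult semiring using (×-comm-*) renaming (_×_ to _·_)
  open RingProperties ring using (-1*x≈-x)
  open SetoidReasoning setoid

  infix 8 -1^_
  -1^_ : Fin N → Carrier
  -1^ j = (- 1#) ^ toℕ j

  -- Of the two indices one keeps its value and the other shifts by one, up or down according to
  -- whether `k` lies above or below `j`. The parity of the sum therefore changes: this is the sign
  -- of a transposition.
  -1^-pinch : (j : Fin (suc N)) (k : Fin N) →
              -1^ punchIn j k * -1^ pinch k j ≈ - (-1^ j * -1^ k)
  -1^-pinch {suc N} zero k = begin
    - 1# * -1^ k * 1#     ≈⟨ *-identityʳ _ ⟩
    - 1# * -1^ k          ≈⟨ -1*x≈-x (-1^ k) ⟩
    - -1^ k               ≈⟨ -‿cong (*-identityˡ _) ⟨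
    - (1# * -1^ k)        ∎
  -1^-pinch (suc j) zero = begin
    1# * -1^ j                ≈⟨ *-identityˡ _ ⟩
    -1^ j                     ≈⟨ solve 1 (λ x → x := :- (:- x)) refl (-1^ j) ⟩
    - (- -1^ j)               ≈⟨ -‿cong (trans (*-identityʳ _) (-1*x≈-x (-1^ j))) ⟨
    - (- 1# * -1^ j * 1#)     ∎
  -1^-pinch (suc j) (suc k) = begin
    - 1# * -1^ punchIn j k * (- 1# * -1^ pinch k j)
      ≈⟨ *-cong (-1*x≈-x _) (-1*x≈-x _) ⟩
    - -1^ punchIn j k * - -1^ pinch k j
      ≈⟨ solve 2 (λ x y → :- x :* :- y := x :* y) refl _ _ ⟩
    -1^ punchIn j k * -1^ pinch k j
      ≈⟨ -1^-pinch j k ⟩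
    - (-1^ j * -1^ k)
      ≈⟨ solve 2 (λ x y → :- (x :* y) := :- (:- x :* :- y)) refl _ _ ⟩
    - (- -1^ j * - -1^ k)
      ≈⟨ -‿cong (*-cong (-1*x≈-x _) (-1*x≈-x _)) ⟨
    - (- 1# * -1^ j * (- 1# * -1^ k)) ∎

  -- A column operation alters two neighboring terms of the expansion and preserves only their sum,
  -- so these two are compared together.
  sum-adjacent : (k : Fin N) (f g : Fin (suc N) → Carrier) →
    (∀ l → l ≢ inject₁ k → l ≢ suc k → f l ≈ g l) →
    f (inject₁ k) + f (suc k) ≈ g (inject₁ k) + g (suc k) → sum f ≈ sum g
  sum-adjacent zero f g f≈g eq = begin
    f zero + (f (suc zero) + sum (λ l → f (suc (suc l))))   ≈⟨ +-assoc _ _ _ ⟨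
    f zero + f (suc zero) + sum (λ l → f (suc (suc l)))     ≈⟨ +-cong eq (sum-cong-≋ λ l → f≈g (suc (suc l)) (λ ()) (λ ())) ⟩
    g zero + g (suc zero) + sum (λ l → g (suc (suc l)))     ≈⟨ +-assoc _ _ _ ⟩
    g zero + (g (suc zero) + sum (λ l → g (suc (suc l))))   ∎
  sum-adjacent (suc k) f g f≈g eq = +-cong (f≈g zero (λ ()) (λ ()))
    (sum-adjacent k (f ∘ suc) (g ∘ suc) (λ l p q → f≈g (suc l) (p ∘ suc-injective) (q ∘ suc-injective)) eq)

  det : ∀ N → (Fin N → Fin N → Carrier) → Carrier
  det zero    A = 1#
  det (suc N) A = sum λ j → -1^ j * (A zero j * det N (λ i k → A (suc i) (punchIn j k)))

  det-cong : ∀ {N} {A B : Fin N → Fin N → Carrier} → (∀ i j → A i j ≈ B i j) → det N A ≈ det N B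
  det-cong {zero}  A≈B = refl
  det-cong {suc N} A≈B = sum-cong-≋ λ j →
    *-congˡ {x = -1^ j} (*-cong (A≈B zero j) (det-cong λ i k → A≈B (suc i) (punchIn j k)))

  det-scale : ∀ {N} (x : Fin N → Carrier) (A : Fin N → Fin N → Carrier) →
              det N (λ i j → x i * A i j) ≈ ∏ x * det N A
  det-scale {zero}  x A = sym (*-identityˡ 1#)
  det-scale {suc N} x A = begin
    sum (λ j → -1^ j * ((x zero * A zero j) * det N (λ i k → x (suc i) * A (suc i) (punchIn j k))))
      ≈⟨ sum-cong-≋ (λ j → trans (*-congˡ (*-congˡ (det-scale (x ∘ suc) (λ i k → A (suc i) (punchIn j k)))))
           (solve 5 (λ s x a p d → s :* ((x :* a) :* (p :* d)) := (x :* p) :* (s :* (a :* d))) refl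
             (-1^ j) (x zero) (A zero j) (∏ (x ∘ suc)) (minor j))) ⟩
    sum (λ j → ∏ x * (-1^ j * (A zero j * minor j)))
      ≈⟨ *-distribˡ-sum (∏ x) (λ j → -1^ j * (A zero j * minor j)) ⟨
    ∏ x * det (suc N) A ∎
    where
    minor : Fin (suc N) → Carrier
    minor j = det N (λ i k → A (suc i) (punchIn j k))

  det-column-linear : ∀ {N} (k : Fin N) c (A B D : Fin N → Fin N → Carrier) →
    (∀ i l → l ≢ k → A i l ≈ B i l) → (∀ i l → l ≢ k → A i l ≈ D i l) →
    (∀ i → A i k ≈ B i k + c * D i k) → det N A ≈ det N B + c * det N D
  det-column-linear {suc N} k c A B D A≈B A≈D A≈B+cD = begin
    sum (term A)                                     ≈⟨ sum-cong-≋ split ⟩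
    sum (λ l → term B l + c * term D l)              ≈⟨ ∑-distrib-+ (term B) (λ l → c * term D l) ⟩
    sum (term B) + sum (λ l → c * term D l)          ≈⟨ +-congˡ (*-distribˡ-sum c (term D)) ⟨
    sum (term B) + c * sum (term D)                  ∎
    where
    minor : (Fin (suc N) → Fin (suc N) → Carrier) → Fin (suc N) → Fin N → Fin N → Carrier
    minor A l i m = A (suc i) (punchIn l m)

    term : (Fin (suc N) → Fin (suc N) → Carrier) → Fin (suc N) → Carrier
    term A l = -1^ l * (A zero l * det N (minor A l))

    split : ∀ l → term A l ≈ term B l + c * term D l
    split l with l ≟ k
    ... | yes ≡.refl = begin
      -1^ l * (A zero l * det N (minor A l))
        ≈⟨ *-congˡ (*-congʳ (A≈B+cD zero)) ⟩
      -1^ l * ((B zero l + c * D zero l) * det N (minor A l))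
        ≈⟨ solve 5 (λ s b c d m → s :* ((b :+ c :* d) :* m) := s :* (b :* m) :+ c :* (s :* (d :* m))) refl _ _ _ _ _ ⟩
      -1^ l * (B zero l * det N (minor A l)) + c * (-1^ l * (D zero l * det N (minor A l)))
        ≈⟨ +-cong (*-congˡ (*-congˡ (det-cong λ i m → A≈B (suc i) _ (punchInᵢ≢i l m))))
                  (*-congˡ (*-congˡ (*-congˡ (det-cong λ i m → A≈D (suc i) _ (punchInᵢ≢i l m))))) ⟩
      term B l + c * term D l ∎
    ... | no l≢k = begin
      -1^ l * (A zero l * det N (minor A l))
        ≈⟨ *-congˡ (*-congˡ (det-column-linear k′ c (minor A l) (minor B l) (minor D l)
             (λ i m m≢k′ → A≈B (suc i) _ (λ eq → m≢k′ (off eq)))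
             (λ i m m≢k′ → A≈D (suc i) _ (λ eq → m≢k′ (off eq)))
             (λ i → at i))) ⟩
      -1^ l * (A zero l * (det N (minor B l) + c * det N (minor D l)))
        ≈⟨ solve 5 (λ s a b c d → s :* (a :* (b :+ c :* d)) := s :* (a :* b) :+ c :* (s :* (a :* d))) refl _ _ _ _ _ ⟩
      -1^ l * (A zero l * det N (minor B l)) + c * (-1^ l * (A zero l * det N (minor D l)))
        ≈⟨ +-cong (*-congˡ (*-congʳ (A≈B zero l l≢k))) (*-congˡ (*-congˡ (*-congʳ (A≈D zero l l≢k)))) ⟩
      term B l + c * term D l ∎
      where
      k′ = punchOut l≢k
      punch = punchIn-punchOut l≢k
      off : ∀ {m} → punchIn l m ≡ k → m ≡ k′
      off eq = punchIn-injective l _ _ (≡.trans eq (≡.sym punch))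
      at : ∀ i → minor A l i k′ ≈ minor B l i k′ + c * minor D l i k′
      at i rewrite punch = A≈B+cD (suc i)

  -- Minors that keep both columns are handled by induction. Deleting either of two adjacent columns
  -- puts the other one in the same place `k`, so the minor without the left column gains exactly
  -- `c` times the minor without the right one. This gain cancels against the change of the entry in
  -- the right column, because the two signs are opposite.
  det-column-op : ∀ {N} (k : Fin N) c (A A′ : Fin (suc N) → Fin (suc N) → Carrier) →
    (∀ i l → l ≢ suc k → A′ i l ≈ A i l) →
    (∀ i → A′ i (suc k) ≈ A i (suc k) + c * A i (inject₁ k)) →
    det (suc N) A′ ≈ det (suc N) A
  det-column-op {suc N} k c A A′ A′≈A A′≈A+cA = sum-adjacent k _ _ others adjacent
    where
    minor : (Fin (suc (suc N)) → Fin (suc (suc N)) → Carrier) → Fin (suc (suc N)) → Fin (suc N) → Fin (suc N) → Carrier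
    minor A l i m = A (suc i) (punchIn l m)

    inject₁≢suc : ∀ {n} (k : Fin n) → inject₁ k ≢ suc k
    inject₁≢suc (suc k) eq = inject₁≢suc k (suc-injective eq)

    others : ∀ l → l ≢ inject₁ k → l ≢ suc k →
      -1^ l * (A′ zero l * det (suc N) (minor A′ l)) ≈ -1^ l * (A zero l * det (suc N) (minor A l))
    others l l≢k l≢sk with k′ , p , q ← punchIn-adjacent k l l≢k l≢sk =
      *-congˡ (*-cong (A′≈A zero l l≢sk) (det-column-op k′ c (minor A l) (minor A′ l)
        (λ i m m≢sk′ → A′≈A (suc i) _ (λ eq → m≢sk′ (punchIn-injective l _ _ (≡.trans eq (≡.sym q)))))
        (λ i → ≡.subst₂ (λ x y → A′ (suc i) y ≈ A (suc i) y + c * A (suc i) x) (≡.sym p) (≡.sym q) (A′≈A+cA (suc i)))))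

    dₖ  = det (suc N) (minor A (inject₁ k))
    dₛₖ = det (suc N) (minor A (suc k))

    minor-k : det (suc N) (minor A′ (inject₁ k)) ≈ dₖ + c * dₛₖ
    minor-k = det-column-linear k c _ _ _
      (λ i m m≢k → A′≈A (suc i) _ (ne m≢k))
      (λ i m m≢k → trans (A′≈A (suc i) _ (ne m≢k)) (reflexive (≡.cong (A (suc i)) (punchIn-inject₁-suc k m m≢k))))
      (λ i → ≡.subst₂ (λ x y → A′ (suc i) y ≈ A (suc i) y + c * A (suc i) x)
        (≡.sym (punchIn-suc-self k)) (≡.sym (punchIn-inject₁-self k)) (A′≈A+cA (suc i)))
      where
      ne : ∀ {m} → m ≢ k → punchIn (inject₁ k) m ≢ suc k
      ne m≢k eq = m≢k (punchIn-injective (inject₁ k) _ _ (≡.trans eq (≡.sym (punchIn-inject₁-self k))))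

    minor-sk : det (suc N) (minor A′ (suc k)) ≈ dₛₖ
    minor-sk = det-cong λ i m → A′≈A (suc i) _ (punchInᵢ≢i (suc k) m)

    adjacent : -1^ inject₁ k * (A′ zero (inject₁ k) * det (suc N) (minor A′ (inject₁ k)))
                 + -1^ suc k * (A′ zero (suc k) * det (suc N) (minor A′ (suc k)))
             ≈ -1^ inject₁ k * (A zero (inject₁ k) * dₖ) + -1^ suc k * (A zero (suc k) * dₛₖ)
    adjacent = begin
      -1^ inject₁ k * (A′ zero (inject₁ k) * det (suc N) (minor A′ (inject₁ k)))
          + -1^ suc k * (A′ zero (suc k) * det (suc N) (minor A′ (suc k)))
        ≈⟨ +-cong (*-cong sgn (*-cong (A′≈A zero _ (inject₁≢suc k)) minor-k))
                  (*-cong (-1*x≈-x s) (*-cong (A′≈A+cA zero) minor-sk)) ⟩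
      s * (a * (dₖ + c * dₛₖ)) + - s * ((b + c * a) * dₛₖ)
        ≈⟨ solve 6 (λ s a b c d e → s :* (a :* (d :+ c :* e)) :+ :- s :* ((b :+ c :* a) :* e)
                      := s :* (a :* d) :+ :- s :* (b :* e)) refl s a b c dₖ dₛₖ ⟩
      s * (a * dₖ) + - s * (b * dₛₖ)
        ≈⟨ +-cong (*-congʳ sgn) (*-congʳ (-1*x≈-x s)) ⟨
      -1^ inject₁ k * (a * dₖ) + -1^ suc k * (b * dₛₖ) ∎
      where
      s = -1^ k
      a = A zero (inject₁ k)
      b = A zero (suc k)
      sgn : -1^ inject₁ k ≈ s
      sgn = reflexive (≡.cong ((- 1#) ^_) (toℕ-inject₁ k))

  -- Rows of powers and the Vandermonde determinant

  sum-scale : ∀ x (f : Fin N → Carrier) → sum (λ j → x * f j) ≈ x * sum f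
  sum-scale x f = sym (*-distribˡ-sum x f)

  -- T w is multiplication by the polynomial x − w, transposed: it kills the
  -- sequence of powers of w.
  T : Carrier → (ℕ → Carrier) → ℕ → Carrier
  T w a k = a (suc k) + - w * a k

  private
    -- Each column operation uses the unaltered column to its left, so the operations run from right
    -- to left. At stage `t` the entries up to `t` are still those of `a` and all later ones are
    -- already reduced; stage 0 is the finished state.
    hybrid : Carrier → ℕ → (ℕ → Carrier) → ℕ → Carrier
    hybrid w zero    a zero    = a zero
    hybrid w zero    a (suc k) = T w a k
    hybrid w (suc t) a zero    = a zero
    hybrid w (suc t) a (suc k) = hybrid w t (a ∘ suc) k

    hybrid-fixed : ∀ w t a k → k ℕ.≤ t → hybrid w t a k ≡ a k
    hybrid-fixed w zero    a zero    _           = ≡.refl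
    hybrid-fixed w (suc t) a zero    _           = ≡.refl
    hybrid-fixed w (suc t) a (suc k) (ℕ.s≤s k≤t) = hybrid-fixed w t (a ∘ suc) k k≤t

    hybrid-moved : ∀ w t a → hybrid w t a (suc t) ≡ T w a t
    hybrid-moved w zero    a = ≡.refl
    hybrid-moved w (suc t) a = hybrid-moved w t (a ∘ suc)

    hybrid-step : ∀ w t a k → k ≢ suc t → hybrid w t a k ≡ hybrid w (suc t) a k
    hybrid-step w zero    a zero          k≢ = ≡.refl
    hybrid-step w zero    a (suc zero)    k≢ = ⊥-elim (k≢ ≡.refl)
    hybrid-step w zero    a (suc (suc k)) k≢ = ≡.refl
    hybrid-step w (suc t) a zero          k≢ = ≡.refl
    hybrid-step w (suc t) a (suc k)       k≢ = hybrid-step w t (a ∘ suc) k (k≢ ∘ ≡.cong suc)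

    det-hybrid : ∀ w (A : Fin (suc N) → ℕ → Carrier) t → t ℕ.≤ N →
      det (suc N) (λ i l → hybrid w zero (A i) (toℕ l)) ≈ det (suc N) (λ i l → hybrid w t (A i) (toℕ l))
    det-hybrid w A zero t≤N = refl
    det-hybrid {N} w A (suc t) t<N = trans (det-hybrid w A t (ℕₚ.<⇒≤ t<N))
      (det-column-op k (- w) _ _
        (λ i l l≢ → reflexive (hybrid-step w t (A i) (toℕ l)
          (λ eq → l≢ (toℕ-injective (≡.trans eq (≡.cong suc (≡.sym k≡t)))))))
        (λ i → reflexive (at i)))
      where
      k = fromℕ< t<N
      k≡t : toℕ k ≡ t
      k≡t = toℕ-fromℕ< t<N
      at : ∀ i → hybrid w t (A i) (suc (toℕ k)) ≡
                 hybrid w (suc t) (A i) (suc (toℕ k)) + - w * hybrid w (suc t) (A i) (toℕ (inject₁ k))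
      at i rewrite toℕ-inject₁ k | k≡t
        | hybrid-fixed w (suc t) (A i) t (ℕₚ.n≤1+n t)
        | hybrid-fixed w t (A i ∘ suc) t ℕₚ.≤-refl = hybrid-moved w t (A i)

  -- In the first row `T w` leaves only the entry `x * w ^ 0`, so a single minor survives, with
  -- `T w` applied to its rows. The factor `x` is carried along because `confluent-suc` strips a
  -- second row that is `w` times a row of powers.
  det-power-row : ∀ w x (A : Fin (suc N) → ℕ → Carrier) → (∀ k → A zero k ≈ x * w ^ k) →
    det (suc N) (λ i l → A i (toℕ l)) ≈ x * det N (λ i l → T w (A (suc i)) (toℕ l))
  det-power-row {N} w x A row = begin
    det (suc N) (λ i l → A i (toℕ l))
      ≈⟨ det-cong (λ i l → reflexive (≡.sym (hybrid-fixed w N (A i) (toℕ l) (ℕ.s≤s⁻¹ (toℕ<n l))))) ⟩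
    det (suc N) (λ i l → hybrid w N (A i) (toℕ l))
      ≈⟨ det-hybrid w A N ℕₚ.≤-refl ⟨
    1# * (A zero zero * D) + sum (λ j → -1^ (suc j) * (T w (A zero) (toℕ j) * minor j))
      ≈⟨ +-cong (trans (*-identityˡ _) (*-congʳ (trans (row zero) (*-identityʳ x))))
                (trans (sum-cong-≋ vanish) (sum-replicate-zero N)) ⟩
    x * D + 0#
      ≈⟨ +-identityʳ _ ⟩
    x * D ∎
    where
    D = det N (λ i l → T w (A (suc i)) (toℕ l))
    minor : Fin N → Carrier
    minor j = det N (λ i l → hybrid w zero (A (suc i)) (toℕ (punchIn (suc j) l)))
    T-row : ∀ k → T w (A zero) k ≈ 0#
    T-row k = begin
      A zero (suc k) + - w * A zero k   ≈⟨ +-cong (row (suc k)) (*-congˡ (row k)) ⟩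
      x * (w * w ^ k) + - w * (x * w ^ k)
        ≈⟨ solve 3 (λ x w p → x :* (w :* p) :+ :- w :* (x :* p) := con 0ℤ) refl x w (w ^ k) ⟩
      0# ∎
    vanish : ∀ j → -1^ (suc j) * (T w (A zero) (toℕ j) * minor j) ≈ 0#
    vanish j = trans (*-congˡ (trans (*-congʳ (T-row (toℕ j))) (zeroˡ _))) (zeroʳ _)

  vandermonde : ∀ n → (Fin n → Carrier) → Carrier
  vandermonde n w = det n (λ i l → w i ^ toℕ l)

  -- The powers of v are an eigenvector of `T (w zero)` with eigenvalue v - `w zero`; pulling the
  -- eigenvalues out of the remaining rows leaves a Vandermonde matrix again.
  vandermonde-suc : ∀ (w : Fin (suc n) → Carrier) →
    vandermonde (suc n) w ≈ ∏ (λ i → w (suc i) - w zero) * vandermonde n (w ∘ suc)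
  vandermonde-suc {n} w = begin
    vandermonde (suc n) w
      ≈⟨ det-power-row (w zero) 1# (λ i k → w i ^ k) (λ k → sym (*-identityˡ _)) ⟩
    1# * det n (λ i l → T (w zero) (w (suc i) ^_) (toℕ l))
      ≈⟨ *-identityˡ _ ⟩
    det n (λ i l → T (w zero) (w (suc i) ^_) (toℕ l))
      ≈⟨ det-cong {n} (λ i l → sym (distribʳ (w (suc i) ^ toℕ l) (w (suc i)) (- w zero))) ⟩
    det n (λ i l → (w (suc i) - w zero) * w (suc i) ^ toℕ l)
      ≈⟨ det-scale (λ i → w (suc i) - w zero) _ ⟩
    ∏ (λ i → w (suc i) - w zero) * vandermonde n (w ∘ suc) ∎

  -- Signed sums over pairs of columns

  sum-swap : ∀ {N} (f g : Fin (suc N) → Fin N → Carrier) →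
    (∀ j k → f j k + f (punchIn j k) (pinch k j) ≈ g j k + g (punchIn j k) (pinch k j)) →
    sum (λ j → sum (f j)) ≈ sum (λ j → sum (g j))
  sum-swap {zero}  f g eq = refl
  sum-swap {suc N} f g eq = begin
    sum (λ j → sum (f j))
      ≈⟨ decompose f ⟩
    sum (λ k → f zero k + f (suc k) zero) + sum (λ j → sum (λ k → f (suc j) (suc k)))
      ≈⟨ +-cong (sum-cong-≋ (eq zero)) (sum-swap (λ j k → f (suc j) (suc k)) (λ j k → g (suc j) (suc k)) (λ j k → eq (suc j) (suc k))) ⟩
    sum (λ k → g zero k + g (suc k) zero) + sum (λ j → sum (λ k → g (suc j) (suc k)))
      ≈⟨ decompose g ⟨
    sum (λ j → sum (g j)) ∎
    where
    -- The pairs that involve 0 form the orbits of `(zero , k)` and `(suc k , zero)` under the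
    -- exchange; the others are a smaller instance of the same double sum.
    decompose : ∀ (f : Fin (suc (suc N)) → Fin (suc N) → Carrier) → sum (λ j → sum (f j)) ≈
      sum (λ k → f zero k + f (suc k) zero) + sum (λ j → sum (λ k → f (suc j) (suc k)))
    decompose f = begin
      sum (f zero) + sum (λ j → f (suc j) zero + sum (λ k → f (suc j) (suc k)))
        ≈⟨ +-congˡ (∑-distrib-+ (λ j → f (suc j) zero) (λ j → sum (λ k → f (suc j) (suc k)))) ⟩
      sum (f zero) + (sum (λ j → f (suc j) zero) + sum (λ j → sum (λ k → f (suc j) (suc k))))
        ≈⟨ +-assoc _ _ _ ⟨
      sum (f zero) + sum (λ j → f (suc j) zero) + sum (λ j → sum (λ k → f (suc j) (suc k)))
        ≈⟨ +-congʳ (∑-distrib-+ (f zero) (λ j → f (suc j) zero)) ⟨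
      sum (λ k → f zero k + f (suc k) zero) + sum (λ j → sum (λ k → f (suc j) (suc k))) ∎

  -- The sum over 𝔖₂ₙ of sgn(σ) ∏ Bᵢ(σ(2i−1), σ(2i)), expanded along the pair
  -- of arguments of B₁.
  pairDet : ∀ n → (Fin n → Fin (n ℕ.* 2) → Fin (n ℕ.* 2) → Carrier) → Carrier
  pairDet zero    B = 1#
  pairDet (suc n) B = sum λ j → sum λ k → (-1^ j * -1^ k) * (B zero j (punchIn j k) *
    pairDet n (λ i a b → B (suc i) (punchIn j (punchIn k a)) (punchIn j (punchIn k b))))

  pairDet-cong : ∀ {n} {B B′ : Fin n → Fin (n ℕ.* 2) → Fin (n ℕ.* 2) → Carrier} →
    (∀ i a b → B i a b ≈ B′ i a b) → pairDet n B ≈ pairDet n B′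
  pairDet-cong {zero}  B≈B′ = refl
  pairDet-cong {suc n} B≈B′ = sum-cong-≋ {suc n ℕ.* 2} λ j → sum-cong-≋ {suc (n ℕ.* 2)} λ k → *-congˡ {x = -1^ j * -1^ k}
    (*-cong (B≈B′ zero j (punchIn j k)) (pairDet-cong λ i a b → B≈B′ (suc i) (punchIn j (punchIn k a)) (punchIn j (punchIn k b))))

  -- Exchanging the two columns of a pair reverses the sign, so only the antisymmetric part of each
  -- `B i` counts. Comparing `B i a b - B i b a`, and not its half, avoids a division by 2. The
  -- lemma is used to remove the restriction a < b, to discard correction terms in `confluent-suc`,
  -- and to count the factor 2 per pair in the full sum.
  pairDet-antisym : ∀ {n} {B B′ : Fin n → Fin (n ℕ.* 2) → Fin (n ℕ.* 2) → Carrier} →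
    (∀ i a b → B i a b - B i b a ≈ B′ i a b - B′ i b a) → pairDet n B ≈ pairDet n B′
  pairDet-antisym {zero}          eq = refl
  pairDet-antisym {suc n} {B} {B′} eq = sum-swap (term B) (term B′) λ j k → begin
    term B j k + term B (punchIn j k) (pinch k j)
      ≈⟨ symmetrize B j k ⟩
    (-1^ j * -1^ k) * ((B zero j (punchIn j k) - B zero (punchIn j k) j) * rest B j k)
      ≈⟨ *-congˡ (*-cong (eq zero _ _) (pairDet-antisym λ i a b → eq (suc i) _ _)) ⟩
    (-1^ j * -1^ k) * ((B′ zero j (punchIn j k) - B′ zero (punchIn j k) j) * rest B′ j k)
      ≈⟨ symmetrize B′ j k ⟨
    term B′ j k + term B′ (punchIn j k) (pinch k j) ∎
    where
    Array = Fin (suc n) → Fin (suc n ℕ.* 2) → Fin (suc n ℕ.* 2) → Carrier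
    rest : Array → Fin (suc n ℕ.* 2) → Fin (suc (n ℕ.* 2)) → Carrier
    rest B j k = pairDet n (λ i a b → B (suc i) (punchIn j (punchIn k a)) (punchIn j (punchIn k b)))
    term : Array → Fin (suc n ℕ.* 2) → Fin (suc (n ℕ.* 2)) → Carrier
    term B j k = (-1^ j * -1^ k) * (B zero j (punchIn j k) * rest B j k)
    symmetrize : ∀ B j k → term B j k + term B (punchIn j k) (pinch k j) ≈
      (-1^ j * -1^ k) * ((B zero j (punchIn j k) - B zero (punchIn j k) j) * rest B j k)
    symmetrize B j k = begin
      term B j k + term B (punchIn j k) (pinch k j)
        ≈⟨ +-congˡ (*-cong (-1^-pinch j k) (*-cong
             (reflexive (≡.cong (B zero (punchIn j k)) (punchIn-pinch j k)))
             (pairDet-cong λ i a b → reflexive (≡.cong₂ (B (suc i)) (punchIn-punchIn-pinch j k a) (punchIn-punchIn-pinch j k b))))) ⟩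
      term B j k + - (-1^ j * -1^ k) * (B zero (punchIn j k) j * rest B j k)
        ≈⟨ solve 4 (λ s x y r → s :* (x :* r) :+ :- s :* (y :* r) := s :* ((x :- y) :* r)) refl
             (-1^ j * -1^ k) (B zero j (punchIn j k)) (B zero (punchIn j k) j) (rest B j k) ⟩
      (-1^ j * -1^ k) * ((B zero j (punchIn j k) - B zero (punchIn j k) j) * rest B j k) ∎

  pairDet-scale : ∀ {n} (x : Fin n → Carrier) (B : Fin n → Fin (n ℕ.* 2) → Fin (n ℕ.* 2) → Carrier) →
    pairDet n (λ i a b → x i * B i a b) ≈ ∏ x * pairDet n B
  pairDet-scale {zero}  x B = sym (*-identityˡ 1#)
  pairDet-scale {suc n} x B = begin
    sum (λ j → sum (λ k → sign j k * ((x zero * b j k) * pairDet n (λ i a b → x (suc i) * B (suc i) (p j k a) (p j k b)))))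
      ≈⟨ sum-cong-≋ (λ j → sum-cong-≋ λ k → trans
           (*-congˡ {x = sign j k} (*-congˡ (pairDet-scale (x ∘ suc) (λ i a b → B (suc i) (p j k a) (p j k b)))))
           (solve 5 (λ s x b y r → s :* ((x :* b) :* (y :* r)) := (x :* y) :* (s :* (b :* r))) refl
             (sign j k) (x zero) (b j k) (∏ (x ∘ suc)) (rest j k))) ⟩
    sum (λ j → sum (λ k → ∏ x * (sign j k * (b j k * rest j k))))
      ≈⟨ sum-cong-≋ (λ j → sum-scale (∏ x) (λ k → sign j k * (b j k * rest j k))) ⟩
    sum (λ j → ∏ x * sum (λ k → sign j k * (b j k * rest j k)))
      ≈⟨ sum-scale (∏ x) (λ j → sum (λ k → sign j k * (b j k * rest j k))) ⟩
    ∏ x * pairDet (suc n) B ∎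
    where
    sign b rest : Fin (suc n ℕ.* 2) → Fin (suc (n ℕ.* 2)) → Carrier
    p : Fin (suc n ℕ.* 2) → Fin (suc (n ℕ.* 2)) → Fin (n ℕ.* 2) → Fin (suc n ℕ.* 2)
    p j k a = punchIn j (punchIn k a)
    sign j k = -1^ j * -1^ k
    b j k = B zero j (punchIn j k)
    rest j k = pairDet n (λ i a b → B (suc i) (p j k a) (p j k b))

  -- When each entry splits into one factor per column, the inner sum over the second column is
  -- itself a Laplace expansion, so a pair of columns accounts for two consecutive rows.
  pairDet-product : ∀ {n} (E D : Fin n → Fin (n ℕ.* 2) → Carrier) →
    pairDet n (λ i a b → E i a * D i b) ≈ det (n ℕ.* 2) (interleave E D)
  pairDet-product {zero}  E D = refl
  pairDet-product {suc n} E D = sum-cong-≋ λ j → begin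
    sum (λ k → (-1^ j * -1^ k) * ((E zero j * D zero (punchIn j k)) * rest j k))
      ≈⟨ sum-cong-≋ (λ k → trans (*-congˡ (*-congˡ (rest≈minor j k)))
           (solve 5 (λ s t e d r → (s :* t) :* ((e :* d) :* r) := (s :* e) :* (t :* (d :* r))) refl
             (-1^ j) (-1^ k) (E zero j) (D zero (punchIn j k)) (minor j k))) ⟩
    sum (λ k → (-1^ j * E zero j) * (-1^ k * (D zero (punchIn j k) * minor j k)))
      ≈⟨ sum-scale (-1^ j * E zero j) (λ k → -1^ k * (D zero (punchIn j k) * minor j k)) ⟩
    (-1^ j * E zero j) * sum (λ k → -1^ k * (D zero (punchIn j k) * minor j k))
      ≈⟨ *-assoc _ _ _ ⟩
    -1^ j * (E zero j * sum (λ k → -1^ k * (D zero (punchIn j k) * minor j k))) ∎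
    where
    rest minor : Fin (suc n ℕ.* 2) → Fin (suc (n ℕ.* 2)) → Carrier
    rest j k = pairDet n (λ i a b → E (suc i) (punchIn j (punchIn k a)) * D (suc i) (punchIn j (punchIn k b)))
    minor j k = det (n ℕ.* 2) (λ r a → interleave (E ∘ suc) (D ∘ suc) r (punchIn j (punchIn k a)))
    rest≈minor : ∀ j k → rest j k ≈ minor j k
    rest≈minor j k = trans
      (pairDet-product (λ i a → E (suc i) (punchIn j (punchIn k a))) (λ i b → D (suc i) (punchIn j (punchIn k b))))
      (det-cong λ r a → reflexive (≡.cong (λ h → h a)
        (interleave-map (λ row a → row (punchIn j (punchIn k a))) (E ∘ suc) (D ∘ suc) r)))

  -- The confluent Vandermonde determinant

  -- The Euler derivative w d/dw of the sequence of powers of w.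
  eulerPowers : Carrier → ℕ → Carrier
  eulerPowers w k = k · (w ^ k)

  T-powers : ∀ w v k → T w (v ^_) k ≈ (v - w) * v ^ k
  T-powers w v k = sym (distribʳ _ _ _)

  -- The Leibniz rule: this is v d/dv applied to `T-powers`. At v = w the first summand vanishes and
  -- w times the powers of w remains.
  T-eulerPowers : ∀ w v k → T w (eulerPowers v) k ≈ (v - w) * eulerPowers v k + v * v ^ k
  T-eulerPowers w v k = begin
    (v * v ^ k + k · (v * v ^ k)) + - w * eulerPowers v k
      ≈⟨ +-congʳ (+-congˡ (×-comm-* k v (v ^ k))) ⟨
    (v * v ^ k + v * eulerPowers v k) + - w * eulerPowers v k
      ≈⟨ solve 4 (λ v p w e → (v :* p :+ v :* e) :+ :- w :* e := (v :- w) :* e :+ v :* p) refl v (v ^ k) w (eulerPowers v k) ⟩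
    (v - w) * eulerPowers v k + v * v ^ k ∎

  T-cong : ∀ w {a b : ℕ → Carrier} → (∀ k → a k ≈ b k) → ∀ k → T w a k ≈ T w b k
  T-cong w a≈b k = +-cong (a≈b (suc k)) (*-congˡ (a≈b k))

  -- Kept as a `pairDet`, so that `pairDet-antisym` applies; `pairDet-product` gives the determinant
  -- on which columns are operated.
  confluent : ∀ n → (Fin n → Carrier) → Carrier
  confluent n w = pairDet n (λ i a b → w i ^ toℕ a * eulerPowers (w i) (toℕ b))

  -- One `T w₀` strips the power row of `w₀` and turns its Euler row into `w₀` times the powers, so
  -- a second one strips that row too and yields the factor `w₀`. On the other rows T² multiplies by
  -- `y i` squared, up to adding a multiple of the power row to the Euler row. This correction is
  -- invisible after antisymmetrization, and the two squares make `y i ^ 4`.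
  confluent-suc : ∀ (w : Fin (suc n) → Carrier) →
    confluent (suc n) w ≈ w zero * (∏ (λ i → (w (suc i) - w zero) ^ 4) * confluent n (w ∘ suc))
  confluent-suc {n} w = begin
    confluent (suc n) w
      ≈⟨ pairDet-product (λ i a → w i ^ toℕ a) (λ i b → eulerPowers (w i) (toℕ b)) ⟩
    det (suc n ℕ.* 2) (interleave (λ i a → w i ^ toℕ a) (λ i b → eulerPowers (w i) (toℕ b)))
      ≈⟨ det-cong (λ r a → reflexive (≡.cong (λ h → h a) (interleave-map (_∘ toℕ) (λ i k → w i ^ k) (λ i → eulerPowers (w i)) r))) ⟩
    det (suc n ℕ.* 2) (λ r a → rows r (toℕ a))
      ≈⟨ det-power-row w₀ 1# rows (λ k → sym (*-identityˡ _)) ⟩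
    1# * det (suc (n ℕ.* 2)) (λ r a → T w₀ (rows (suc r)) (toℕ a))
      ≈⟨ *-identityˡ _ ⟩
    det (suc (n ℕ.* 2)) (λ r a → T w₀ (rows (suc r)) (toℕ a))
      ≈⟨ det-power-row w₀ w₀ (λ r → T w₀ (rows (suc r))) T-row ⟩
    w₀ * det (n ℕ.* 2) (λ r a → T w₀ (T w₀ (rows (suc (suc r)))) (toℕ a))
      ≈⟨ *-congˡ (det-cong λ r a → reflexive (≡.cong (λ h → h a)
           (interleave-map (λ row a → T w₀ (T w₀ row) (toℕ a)) (λ i k → w (suc i) ^ k) (λ i → eulerPowers (w (suc i))) r))) ⟨
    w₀ * det (n ℕ.* 2) (interleave (λ i a → P i (toℕ a)) (λ i b → Q i (toℕ b)))
      ≈⟨ *-congˡ (pairDet-product (λ i a → P i (toℕ a)) (λ i b → Q i (toℕ b))) ⟨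
    w₀ * pairDet n (λ i a b → P i (toℕ a) * Q i (toℕ b))
      ≈⟨ *-congˡ (pairDet-antisym λ i a b → antisym i (toℕ a) (toℕ b)) ⟩
    w₀ * pairDet n (λ i a b → y i ^ 4 * (v i ^ toℕ a * eulerPowers (v i) (toℕ b)))
      ≈⟨ *-congˡ (pairDet-scale (λ i → y i ^ 4) _) ⟩
    w₀ * (∏ (λ i → y i ^ 4) * confluent n v) ∎
    where
    w₀ = w zero
    v : Fin n → Carrier
    v i = w (suc i)
    y : Fin n → Carrier
    y i = v i - w₀
    rows : Fin (suc n ℕ.* 2) → ℕ → Carrier
    rows = interleave (λ i k → w i ^ k) (λ i → eulerPowers (w i))
    P Q : Fin n → ℕ → Carrier
    P i = T w₀ (T w₀ (v i ^_))
    Q i = T w₀ (T w₀ (eulerPowers (v i)))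

    T-row : ∀ k → T w₀ (eulerPowers w₀) k ≈ w₀ * w₀ ^ k
    T-row k = trans (T-eulerPowers w₀ w₀ k)
      (solve 3 (λ w e p → (w :- w) :* e :+ p := p) refl w₀ (eulerPowers w₀ k) (w₀ * w₀ ^ k))

    P≈ : ∀ i k → P i k ≈ y i * (y i * v i ^ k)
    P≈ i k = begin
      T w₀ (T w₀ (v i ^_)) k             ≈⟨ T-cong w₀ (T-powers w₀ (v i)) k ⟩
      y i * (v i * v i ^ k) + - w₀ * (y i * v i ^ k)
        ≈⟨ solve 3 (λ v w p → (v :- w) :* (v :* p) :+ :- w :* ((v :- w) :* p) := (v :- w) :* ((v :- w) :* p)) refl (v i) w₀ (v i ^ k) ⟩
      y i * (y i * v i ^ k) ∎

    Q≈ : ∀ i k → Q i k ≈ y i * (y i * eulerPowers (v i) k) + (y i * v i + y i * v i) * v i ^ k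
    Q≈ i k = begin
      T w₀ (T w₀ (eulerPowers (v i))) k
        ≈⟨ T-cong w₀ (T-eulerPowers w₀ (v i)) k ⟩
      (y i * eulerPowers (v i) (suc k) + v i * (v i * v i ^ k)) + - w₀ * (y i * e + v i * v i ^ k)
        ≈⟨ solve 6 (λ y e′ v p w e → (y :* e′ :+ v :* (v :* p)) :+ :- w :* (y :* e :+ v :* p)
                     := y :* (e′ :+ :- w :* e) :+ (v :- w) :* (v :* p)) refl
             (y i) (eulerPowers (v i) (suc k)) (v i) (v i ^ k) w₀ e ⟩
      y i * T w₀ (eulerPowers (v i)) k + y i * (v i * v i ^ k)
        ≈⟨ +-congʳ (*-congˡ (T-eulerPowers w₀ (v i) k)) ⟩
      y i * (y i * e + v i * v i ^ k) + y i * (v i * v i ^ k)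
        ≈⟨ solve 4 (λ y e v p → y :* (y :* e :+ v :* p) :+ y :* (v :* p) := y :* (y :* e) :+ (y :* v :+ y :* v) :* p) refl
             (y i) e (v i) (v i ^ k) ⟩
      y i * (y i * e) + (y i * v i + y i * v i) * v i ^ k ∎
      where e = eulerPowers (v i) k

    -- The correction with coefficient `x` contributes the same multiple of `p * q` to both products
    -- and cancels in the difference.
    antisym : ∀ i a b → P i a * Q i b - P i b * Q i a ≈
      y i ^ 4 * (v i ^ a * eulerPowers (v i) b) - y i ^ 4 * (v i ^ b * eulerPowers (v i) a)
    antisym i a b = begin
      P i a * Q i b - P i b * Q i a
        ≈⟨ +-cong (*-cong (P≈ i a) (Q≈ i b)) (-‿cong (*-cong (P≈ i b) (Q≈ i a))) ⟩
      y i * (y i * p) * (y i * (y i * f) + x * q) - y i * (y i * q) * (y i * (y i * e) + x * p)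
        ≈⟨ solve 6 (λ y p q e f x →
             y :* (y :* p) :* (y :* (y :* f) :+ x :* q) :- y :* (y :* q) :* (y :* (y :* e) :+ x :* p)
             := (y :* (y :* (y :* y))) :* (p :* f) :- (y :* (y :* (y :* y))) :* (q :* e)) refl (y i) p q e f x ⟩
      y i * (y i * (y i * y i)) * (p * f) - y i * (y i * (y i * y i)) * (q * e)
        ≈⟨ +-cong (*-congʳ fourth) (-‿cong (*-congʳ fourth)) ⟩
      y i ^ 4 * (p * f) - y i ^ 4 * (q * e) ∎
      where
      p = v i ^ a
      q = v i ^ b
      e = eulerPowers (v i) a
      f = eulerPowers (v i) b
      x = y i * v i + y i * v i
      fourth : y i * (y i * (y i * y i)) ≈ y i ^ 4
      fourth = *-congˡ (*-congˡ (*-congˡ (sym (*-identityʳ (y i)))))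

  1^ : ∀ k → 1# ^ k ≈ 1#
  1^ zero    = refl
  1^ (suc k) = trans (*-identityˡ _) (1^ k)

  ∏-^ : ∀ {N} (x : Fin N → Carrier) k → ∏ (λ i → x i ^ k) ≈ ∏ x ^ k
  ∏-^ {zero}  x k = sym (1^ k)
  ∏-^ {suc N} x k = trans (*-congˡ (∏-^ (x ∘ suc) k)) (sym (^-distrib-* (x zero) (∏ (x ∘ suc)) k))

  confluent-vandermonde : ∀ n (w : Fin n → Carrier) → confluent n w ≈ ∏ w * vandermonde n w ^ 4
  confluent-vandermonde zero    w = sym (trans (*-identityˡ _) (1^ 4))
  confluent-vandermonde (suc n) w = begin
    confluent (suc n) w
      ≈⟨ confluent-suc w ⟩
    w zero * (∏ (λ i → (w (suc i) - w zero) ^ 4) * confluent n (w ∘ suc))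
      ≈⟨ *-congˡ (*-cong (∏-^ (λ i → w (suc i) - w zero) 4) (confluent-vandermonde n (w ∘ suc))) ⟩
    w zero * (p ^ 4 * (∏ (w ∘ suc) * V ^ 4))
      ≈⟨ solve 4 (λ w p q v → w :* (p :* (q :* v)) := (w :* q) :* (p :* v)) refl _ _ _ _ ⟩
    ∏ w * (p ^ 4 * V ^ 4)
      ≈⟨ *-congˡ (^-distrib-* p V 4) ⟨
    ∏ w * (p * V) ^ 4
      ≈⟨ *-congˡ (^-congˡ 4 (vandermonde-suc w)) ⟨
    ∏ w * vandermonde (suc n) w ^ 4 ∎
    where
    p = ∏ (λ i → w (suc i) - w zero)
    V = vandermonde n (w ∘ suc)

-- Sums over lists in a commutative monoid

module ListSums {c ℓ} (M : CommutativeMonoid c ℓ) where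
  open CommutativeMonoid M
  open CommutativeMonoidSum M using (sum)
  open SetoidReasoning setoid

  ∑ : List X → (X → Carrier) → Carrier
  ∑ xs f = foldr (λ x s → f x ∙ s) ε xs

  ∑-cong : ∀ (xs : List X) {f g : X → Carrier} → (∀ x → f x ≈ g x) → ∑ xs f ≈ ∑ xs g
  ∑-cong []       f≈g = refl
  ∑-cong (x ∷ xs) f≈g = ∙-cong (f≈g x) (∑-cong xs f≈g)

  ∑-++ : ∀ (xs ys : List X) f → ∑ (xs List.++ ys) f ≈ ∑ xs f ∙ ∑ ys f
  ∑-++ []       ys f = sym (identityˡ _)
  ∑-++ (x ∷ xs) ys f = trans (∙-congˡ (∑-++ xs ys f)) (sym (assoc _ _ _))

  ∑-map : ∀ (g : X → Y) xs f → ∑ (List.map g xs) f ≡ ∑ xs (f ∘ g)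
  ∑-map g []       f = ≡.refl
  ∑-map g (x ∷ xs) f = ≡.cong (f (g x) ∙_) (∑-map g xs f)

  ∑-cartesianProductWith : ∀ (h : X → Y → XY) xs ys f →
    ∑ (cartesianProductWith h xs ys) f ≈ ∑ xs (λ x → ∑ ys (λ y → f (h x y)))
  ∑-cartesianProductWith h []       ys f = refl
  ∑-cartesianProductWith h (x ∷ xs) ys f = begin
    ∑ (List.map (h x) ys List.++ cartesianProductWith h xs ys) f
      ≈⟨ ∑-++ (List.map (h x) ys) _ f ⟩
    ∑ (List.map (h x) ys) f ∙ ∑ (cartesianProductWith h xs ys) f
      ≈⟨ ∙-cong (reflexive (∑-map (h x) ys f)) (∑-cartesianProductWith h xs ys f) ⟩
    ∑ ys (λ y → f (h x y)) ∙ ∑ xs (λ x → ∑ ys (λ y → f (h x y))) ∎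

  ∑-tabulate : ∀ {n} (g : Fin n → X) f → ∑ (tabulate g) f ≡ sum (f ∘ g)
  ∑-tabulate {n = zero}  g f = ≡.refl
  ∑-tabulate {n = suc n} g f = ≡.cong (f (g zero) ∙_) (∑-tabulate (g ∘ suc) f)

  ∑-allFin : ∀ n f → ∑ (allFin n) f ≡ sum f
  ∑-allFin n f = ∑-tabulate id f

  ∑-filter : ∀ {P : Pred X ρ} (P? : Decidable P) xs f →
    ∑ (filter P? xs) f ≈ ∑ xs (λ x → if does (P? x) then f x else ε)
  ∑-filter P? []       f = refl
  ∑-filter P? (x ∷ xs) f with does (P? x)
  ... | true  = ∙-congˡ (∑-filter P? xs f)
  ... | false = trans (∑-filter P? xs f) (sym (identityˡ _))

-- Inversion numbers

private
  module ℕ-Sum = CommutativeMonoidSum ℕₚ.+-0-commutativeMonoid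
  module ℕ-∑ = ListSums ℕₚ.+-0-commutativeMonoid

indicator : Bool → ℕ
indicator b = if b then 1 else 0

_<ᵇ_ : Fin N → Fin N → Bool
i <ᵇ j = toℕ i ℕ.<ᵇ toℕ j

length≡∑ : (xs : List X) → length xs ≡ ℕ-∑.∑ xs (const 1)
length≡∑ []       = ≡.refl
length≡∑ (x ∷ xs) = ≡.cong suc (length≡∑ xs)

length-filter-pairs : ∀ {P : Pred (Fin N × Fin N) ρ} (P? : Decidable P) →
  length (filter P? (cartesianProduct (allFin N) (allFin N))) ≡
  ℕ-Sum.sum λ i → ℕ-Sum.sum λ j → indicator (does (P? (i , j)))
length-filter-pairs {N = N} P? = begin
  length (filter P? pairs)
    ≡⟨ length≡∑ (filter P? pairs) ⟩
  ℕ-∑.∑ (filter P? pairs) (const 1)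
    ≡⟨ ℕ-∑.∑-filter P? pairs (const 1) ⟩
  ℕ-∑.∑ pairs f
    ≡⟨ ℕ-∑.∑-cartesianProductWith _,_ (allFin N) (allFin N) f ⟩
  ℕ-∑.∑ (allFin N) (λ i → ℕ-∑.∑ (allFin N) (λ j → f (i , j)))
    ≡⟨ ℕ-∑.∑-cong (allFin N) (λ i → ℕ-∑.∑-allFin N (λ j → f (i , j))) ⟩
  ℕ-∑.∑ (allFin N) (λ i → ℕ-Sum.sum (λ j → f (i , j)))
    ≡⟨ ℕ-∑.∑-allFin N (λ i → ℕ-Sum.sum (λ j → f (i , j))) ⟩
  ℕ-Sum.sum (λ i → ℕ-Sum.sum (λ j → f (i , j))) ∎
  where
  open ≡.≡-Reasoning
  pairs = cartesianProduct (allFin N) (allFin N)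
  f : Fin N × Fin N → ℕ
  f ij = indicator (does (P? ij))

inversions≡sum : (σ : Permutation′ N) → inversions σ ≡
  ℕ-Sum.sum λ i → ℕ-Sum.sum λ j → indicator ((i <ᵇ j) ∧ ((σ ⟨$⟩ʳ j) <ᵇ (σ ⟨$⟩ʳ i)))
-- The predicate, local to `inversions`, is found by unification; its decision computes to the
-- conjunction of the two Boolean comparisons.
inversions≡sum {N} σ = length-filter-pairs {N = N} _

punchIn-<ᵇ : (p : Fin (suc N)) (i j : Fin N) → (punchIn p i <ᵇ punchIn p j) ≡ (i <ᵇ j)
punchIn-<ᵇ zero    i       j       = ≡.refl
punchIn-<ᵇ (suc p) zero    zero    = ≡.refl
punchIn-<ᵇ (suc p) zero    (suc j) = ≡.refl
punchIn-<ᵇ (suc p) (suc i) zero    = ≡.refl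
punchIn-<ᵇ (suc p) (suc i) (suc j) = punchIn-<ᵇ p i j

sum-punchIn-below : (p : Fin (suc N)) → ℕ-Sum.sum (λ j → indicator (punchIn p j <ᵇ p)) ≡ toℕ p
sum-punchIn-below {N}     zero    = ℕ-Sum.sum-replicate-zero N
sum-punchIn-below {suc N} (suc p) = ≡.cong suc (sum-punchIn-below p)

-- Inversions that involve position 0 correspond to values below `p`, and there are `toℕ p` of these
-- whatever `π` is, by reindexing along `π`. The remaining ones are those of `π`, since `punchIn p`
-- preserves the order. Hence the Laplace sign.
inversions-insert : (p : Fin (suc N)) (π : Permutation′ N) →
  inversions (insert zero p π) ≡ toℕ p ℕ.+ inversions π
inversions-insert {N} p π = ≡.trans (inversions≡sum (insert zero p π)) (≡.cong₂ ℕ._+_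
  (≡.trans (≡.sym (ℕ-Sum.sum-permute (λ j → indicator (punchIn p j <ᵇ p)) π)) (sum-punchIn-below p))
  (≡.trans (ℕ-Sum.sum-cong-≗ λ i → ℕ-Sum.sum-cong-≗ λ j →
      ≡.cong (λ b → indicator ((i <ᵇ j) ∧ b)) (punchIn-<ᵇ p (π ⟨$⟩ʳ j) (π ⟨$⟩ʳ i)))
    (≡.sym (inversions≡sum π))))

-- Signed sums over permutations

module PermutationSums {c ℓ} (R : CommutativeRing c ℓ) where
  open CommutativeRing R hiding (zero)
  open IntegerCoefficients R using (solve; _:=_; _:*_; _:-_; :-_; con; _:^_)
  open Determinants R
  open ListSums +-commutativeMonoid
  open Exp commutativeSemiring using (_^_; ^-congˡ; ^-distrib-*; ^-homo-*; ^-assocʳ)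
  open SemiringSum semiring using (sum; sum-cong-≋)
  open CommutativeMonoidSum *-commutativeMonoid using ()
    renaming (sum to ∏; sum-cong-≋ to ∏-cong; ∑-distrib-+ to ∏-distrib-*; sum-replicate to ∏-replicate)
  open Mult semiring using (×-congʳ; ×-assoc-*) renaming (_×_ to _·_)
  open SetoidReasoning setoid

  sign : Permutation′ N → Carrier
  sign σ = (- 1#) ^ inversions σ

  ∑-scale : ∀ (xs : List X) x f → ∑ xs (λ y → x * f y) ≈ x * ∑ xs f
  ∑-scale []       x f = sym (zeroʳ x)
  ∑-scale (y ∷ xs) x f = trans (+-congˡ (∑-scale xs x f)) (sym (distribˡ x _ _))

  -- The summand sees a permutation only as a function, built from the image of its first point;
  -- this gives the same recursion as in `det` and `pairDet`.
  altSum : ∀ N → ((Fin N → Fin N) → Carrier) → Carrier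
  altSum zero    G = G id
  altSum (suc N) G = sum λ j → -1^ j * altSum N (λ τ → G (j F.∷ (punchIn j ∘ τ)))

  altSum-cong : ∀ {N} {G H : (Fin N → Fin N) → Carrier} → (∀ τ → G τ ≈ H τ) → altSum N G ≈ altSum N H
  altSum-cong {zero}  G≈H = G≈H id
  altSum-cong {suc N} G≈H = sum-cong-≋ λ j → *-congˡ {x = -1^ j} (altSum-cong λ τ → G≈H (j F.∷ (punchIn j ∘ τ)))

  altSum-scale : ∀ {N} x (G : (Fin N → Fin N) → Carrier) → altSum N (λ τ → x * G τ) ≈ x * altSum N G
  altSum-scale {zero}  x G = refl
  altSum-scale {suc N} x G = begin
    sum (λ j → -1^ j * altSum N (λ τ → x * G (j F.∷ (punchIn j ∘ τ))))
      ≈⟨ sum-cong-≋ (λ j → trans (*-congˡ (altSum-scale x (λ τ → G (j F.∷ (punchIn j ∘ τ)))))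
           (solve 3 (λ s x g → s :* (x :* g) := x :* (s :* g)) refl (-1^ j) x _)) ⟩
    sum (λ j → x * (-1^ j * altSum N (λ τ → G (j F.∷ (punchIn j ∘ τ)))))
      ≈⟨ sum-scale x (λ j → -1^ j * altSum N (λ τ → G (j F.∷ (punchIn j ∘ τ)))) ⟩
    x * altSum (suc N) G ∎

  -- The forward map of `insert zero j π` agrees only pointwise with
  -- `j F.∷ (punchIn j ∘ (π ⟨$⟩ʳ_))`, which is why `G` is required to respect pointwise equality.
  ∑-perms : ∀ N (G : (Fin N → Fin N) → Carrier) → (∀ {f g} → f ≗ g → G f ≈ G g) →
    ∑ (perms N) (λ σ → sign σ * G (σ ⟨$⟩ʳ_)) ≈ altSum N G
  ∑-perms zero    G G-resp = trans (+-identityʳ _) (trans (*-identityˡ _) (G-resp λ ()))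
  ∑-perms (suc N) G G-resp = begin
    ∑ (perms (suc N)) (λ σ → sign σ * G (σ ⟨$⟩ʳ_))
      ≈⟨ ∑-cartesianProductWith (insert zero) (allFin (suc N)) (perms N) _ ⟩
    ∑ (allFin (suc N)) (λ j → ∑ (perms N) (λ π → sign (insert zero j π) * G (insert zero j π ⟨$⟩ʳ_)))
      ≡⟨ ∑-allFin (suc N) (λ j → ∑ (perms N) (λ π → sign (insert zero j π) * G (insert zero j π ⟨$⟩ʳ_))) ⟩
    sum (λ j → ∑ (perms N) (λ π → sign (insert zero j π) * G (insert zero j π ⟨$⟩ʳ_)))
      ≈⟨ sum-cong-≋ (λ j → trans (∑-cong (perms N) (step j)) (∑-scale (perms N) (-1^ j) _)) ⟩
    sum (λ j → -1^ j * ∑ (perms N) (λ π → sign π * G (j F.∷ (punchIn j ∘ (π ⟨$⟩ʳ_)))))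
      ≈⟨ sum-cong-≋ (λ j → *-congˡ {x = -1^ j} (∑-perms N (λ τ → G (j F.∷ (punchIn j ∘ τ)))
           (λ f≗g → G-resp λ { zero → ≡.refl ; (suc i) → ≡.cong (punchIn j) (f≗g i) }))) ⟩
    altSum (suc N) G ∎
    where
    step : ∀ j π → sign (insert zero j π) * G (insert zero j π ⟨$⟩ʳ_)
                 ≈ -1^ j * (sign π * G (j F.∷ (punchIn j ∘ (π ⟨$⟩ʳ_))))
    step j π = trans (*-cong
      (trans (reflexive (≡.cong ((- 1#) ^_) (inversions-insert j π))) (^-homo-* (- 1#) (toℕ j) (inversions π)))
      (G-resp λ { zero → ≡.refl ; (suc i) → ≡.refl })) (*-assoc _ _ _)

  ∑-perms-det : ∀ (A : Fin N → Fin N → Carrier) →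
    ∑ (perms N) (λ σ → sign σ * ∏ (λ i → A i (σ ⟨$⟩ʳ i))) ≈ det N A
  ∑-perms-det A = trans (∑-perms _ (λ τ → ∏ (λ i → A i (τ i)))
      (λ f≗g → ∏-cong λ i → reflexive (≡.cong (A i) (f≗g i)))) (altSum-∏ A)
    where
    altSum-∏ : ∀ {N} (A : Fin N → Fin N → Carrier) → altSum N (λ τ → ∏ (λ i → A i (τ i))) ≈ det N A
    altSum-∏ {zero}  A = refl
    altSum-∏ {suc N} A = sum-cong-≋ λ j → *-congˡ {x = -1^ j} (trans
      (altSum-scale (A zero j) (λ τ → ∏ (λ i → A (suc i) (punchIn j (τ i)))))
      (*-congˡ (altSum-∏ (λ i k → A (suc i) (punchIn j k)))))

  ∑-perms-pairDet : ∀ (B : Fin n → Fin (n ℕ.* 2) → Fin (n ℕ.* 2) → Carrier) →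
    ∑ (perms (n ℕ.* 2)) (λ σ → sign σ * ∏ (λ i → B i (σ ⟨$⟩ʳ odd i) (σ ⟨$⟩ʳ even i))) ≈ pairDet n B
  ∑-perms-pairDet B = trans (∑-perms _ (λ τ → ∏ (λ i → B i (τ (odd i)) (τ (even i))))
      (λ f≗g → ∏-cong λ i → reflexive (≡.cong₂ (B i) (f≗g (odd i)) (f≗g (even i))))) (altSum-pairs B)
    where
    altSum-pairs : ∀ {n} (B : Fin n → Fin (n ℕ.* 2) → Fin (n ℕ.* 2) → Carrier) →
      altSum (n ℕ.* 2) (λ τ → ∏ (λ i → B i (τ (odd i)) (τ (even i)))) ≈ pairDet n B
    altSum-pairs {zero}  B = refl
    altSum-pairs {suc n} B = sum-cong-≋ λ j → begin
      -1^ j * sum (λ k → -1^ k * altSum (n ℕ.* 2) (λ τ → B₀ j k * ∏ (λ i → B′ j k i (τ (odd i)) (τ (even i)))))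
        ≈⟨ sum-scale (-1^ j) (λ k → -1^ k * altSum (n ℕ.* 2) (λ τ → B₀ j k * ∏ (λ i → B′ j k i (τ (odd i)) (τ (even i))))) ⟨
      sum (λ k → -1^ j * (-1^ k * altSum (n ℕ.* 2) (λ τ → B₀ j k * ∏ (λ i → B′ j k i (τ (odd i)) (τ (even i))))))
        ≈⟨ sum-cong-≋ (λ k → trans (sym (*-assoc (-1^ j) (-1^ k) _)) (*-congˡ (trans
             (altSum-scale (B₀ j k) (λ τ → ∏ (λ i → B′ j k i (τ (odd i)) (τ (even i)))))
             (*-congˡ (altSum-pairs (B′ j k)))))) ⟩
      sum (λ k → (-1^ j * -1^ k) * (B₀ j k * pairDet n (B′ j k))) ∎
      where
      B₀ : Fin (suc n ℕ.* 2) → Fin (suc (n ℕ.* 2)) → Carrier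
      B₀ j k = B zero j (punchIn j k)
      B′ : Fin (suc n ℕ.* 2) → Fin (suc (n ℕ.* 2)) → Fin n → Fin (n ℕ.* 2) → Fin (n ℕ.* 2) → Carrier
      B′ j k i a b = B (suc i) (punchIn j (punchIn k a)) (punchIn j (punchIn k b))

  above : (Fin N → Fin N → Carrier) → Fin N → Fin N → Carrier
  above B a b = if does (a <? b) then B a b else 0#

  ∏-zero : ∀ {N} (x : Fin N → Carrier) i → x i ≈ 0# → ∏ x ≈ 0#
  ∏-zero x zero    x₀≈0 = trans (*-congʳ x₀≈0) (zeroˡ _)
  ∏-zero x (suc i) xᵢ≈0 = trans (*-congˡ (∏-zero (x ∘ suc) i xᵢ≈0)) (zeroʳ _)

  -- A product of truncated entries vanishes as soon as one pair decreases, so the condition that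
  -- defines 𝔈 moves into the array and the sum extends to all permutations.
  ∑-𝔈-pairDet : ∀ (B : Fin n → Fin (n ℕ.* 2) → Fin (n ℕ.* 2) → Carrier) →
    ∑ (𝔈 n) (λ σ → sign σ * ∏ (λ i → B i (σ ⟨$⟩ʳ odd i) (σ ⟨$⟩ʳ even i))) ≈ pairDet n (λ i → above (B i))
  ∑-𝔈-pairDet {n} B = trans (∑-filter (pairIncreasing? n) (perms (n ℕ.* 2)) _)
    (trans (∑-cong (perms (n ℕ.* 2)) λ σ → step σ (pairIncreasing? n σ)) (∑-perms-pairDet (λ i → above (B i))))
    where
    entry : Permutation′ (n ℕ.* 2) → Fin n → Carrier
    entry σ i = B i (σ ⟨$⟩ʳ odd i) (σ ⟨$⟩ʳ even i)
    step : ∀ σ (inc? : Dec (PairIncreasing n σ)) → (if does inc? then sign σ * ∏ (entry σ) else 0#)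
         ≈ sign σ * ∏ (λ i → above (B i) (σ ⟨$⟩ʳ odd i) (σ ⟨$⟩ʳ even i))
    step σ (yes inc) = *-congˡ (∏-cong λ i → reflexive (≡.cong (λ t → if t then entry σ i else 0#)
      (≡.sym (dec-true (σ ⟨$⟩ʳ odd i <? σ ⟨$⟩ʳ even i) (inc i)))))
    step σ (no ¬inc) with i , ¬incᵢ ← ¬∀⟶∃¬ n _ (λ i → σ ⟨$⟩ʳ odd i <? σ ⟨$⟩ʳ even i) ¬inc =
      sym (trans (*-congˡ (∏-zero _ i (reflexive (≡.cong (λ t → if t then entry σ i else 0#)
        (dec-false (σ ⟨$⟩ʳ odd i <? σ ⟨$⟩ʳ even i) ¬incᵢ))))) (zeroʳ _))

  -- Off the diagonal exactly one truncation survives, on it none. An alternating array is thus the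
  -- antisymmetrization of its upper half, while its own antisymmetrization is its double.
  -- Antisymmetry alone gives only `E a a + E a a ≈ 0#`, so the diagonal has its own hypothesis.
  above-antisym : ∀ (E : Fin N → Fin N → Carrier) → (∀ a b → E b a ≈ - E a b) → (∀ a → E a a ≈ 0#) →
    ∀ a b → above E a b - above E b a ≈ E a b
  above-antisym E anti diag a b with <-cmp a b
  ... | tri< a<b _ b≮a rewrite dec-true (a <? b) a<b | dec-false (b <? a) b≮a =
    solve 1 (λ x → x :- con 0ℤ := x) refl (E a b)
  ... | tri> a≮b _ b<a rewrite dec-false (a <? b) a≮b | dec-true (b <? a) b<a =
    trans (+-identityˡ _) (sym (anti b a))
  ... | tri≈ a≮a ≡.refl _ rewrite dec-false (a <? a) a≮a =
    trans (-‿inverseʳ 0#) (sym (diag a))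

  -- The pair sum as a product of squared Vandermonde determinants

  -- In the application wᵢ is the inverse of the i-th coordinate zᵢ of the torus.
  -- The columns a and b are zero-based, whence the factor wᵢ².
  module _ {n} (w z : Fin n → Carrier) where

    prefactor : Fin n → Carrier
    prefactor i = z i ^ (2 ℕ.* n ℕ.+ 1) * w i ^ 2

    pairEntry : Fin n → Fin (n ℕ.* 2) → Fin (n ℕ.* 2) → Carrier
    pairEntry i a b = prefactor i * ((toℕ b · 1# - toℕ a · 1#) * (w i ^ toℕ a * w i ^ toℕ b))

  shiftedVandermonde : ∀ n → (Fin n → Carrier) → Carrier
  shiftedVandermonde n x = det n (λ i l → x i ^ suc (toℕ l))

  shiftedVandermonde-vandermonde : ∀ (x : Fin n → Carrier) → shiftedVandermonde n x ≈ ∏ x * vandermonde n x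
  shiftedVandermonde-vandermonde x = det-scale x (λ i l → x i ^ toℕ l)

  -- From wᵢ - wⱼ = wᵢ wⱼ (zⱼ - zᵢ), each squared difference absorbs zᵢ² zⱼ², and the square removes
  -- the sign. Each index lies in n - 1 pairs; the exponent `n` avoids a subtraction and leaves the
  -- surplus `∏ z ^ 2` on the right.
  vandermonde-inverse : ∀ {n} (w z : Fin n → Carrier) → (∀ i → w i * z i ≈ 1#) →
    vandermonde n w ^ 2 * (∏ z ^ 2) ^ n ≈ ∏ z ^ 2 * vandermonde n z ^ 2
  vandermonde-inverse {zero}  w z wz≈1 = trans (*-identityʳ _) (sym (trans (*-congʳ (1^ 2)) (*-identityˡ _)))
  vandermonde-inverse {suc n} w z wz≈1 = begin
    vandermonde (suc n) w ^ 2 * (∏ z ^ 2) ^ suc n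
      ≈⟨ *-cong (^-congˡ 2 (vandermonde-suc w)) (^-congˡ (suc n) (^-distrib-* z₀ Z 2)) ⟩
    (p * V) ^ 2 * (z₀ ^ 2 * Z ^ 2) ^ suc n
      ≈⟨ *-cong (^-distrib-* p V 2) (*-congˡ (^-distrib-* (z₀ ^ 2) (Z ^ 2) n)) ⟩
    (p ^ 2 * V ^ 2) * ((z₀ ^ 2 * Z ^ 2) * ((z₀ ^ 2) ^ n * (Z ^ 2) ^ n))
      ≈⟨ solve 6 (λ p v z Z zn Zn → (p :* v) :* ((z :* Z) :* (zn :* Zn)) := (z :* (p :* Z :* zn)) :* (v :* Zn)) refl
           (p ^ 2) (V ^ 2) (z₀ ^ 2) (Z ^ 2) ((z₀ ^ 2) ^ n) ((Z ^ 2) ^ n) ⟩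
    (z₀ ^ 2 * (p ^ 2 * Z ^ 2 * (z₀ ^ 2) ^ n)) * (V ^ 2 * (Z ^ 2) ^ n)
      ≈⟨ *-cong (*-congˡ differences) (vandermonde-inverse (w ∘ suc) (z ∘ suc) (wz≈1 ∘ suc)) ⟩
    (z₀ ^ 2 * q ^ 2) * (Z ^ 2 * U ^ 2)
      ≈⟨ solve 4 (λ z q Z u → (z :* q) :* (Z :* u) := (z :* Z) :* (q :* u)) refl (z₀ ^ 2) (q ^ 2) (Z ^ 2) (U ^ 2) ⟩
    (z₀ ^ 2 * Z ^ 2) * (q ^ 2 * U ^ 2)
      ≈⟨ *-cong (^-distrib-* z₀ Z 2) (^-distrib-* q U 2) ⟨
    ∏ z ^ 2 * (q * U) ^ 2
      ≈⟨ *-congˡ (^-congˡ 2 (vandermonde-suc z)) ⟨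
    ∏ z ^ 2 * vandermonde (suc n) z ^ 2 ∎
    where
    z₀ = z zero
    w₀ = w zero
    Z = ∏ (z ∘ suc)
    V = vandermonde n (w ∘ suc)
    U = vandermonde n (z ∘ suc)
    p = ∏ (λ i → w (suc i) - w₀)
    q = ∏ (λ i → z (suc i) - z₀)

    square : ∀ i → (w (suc i) - w₀) ^ 2 * z (suc i) ^ 2 * z₀ ^ 2 ≈ (z (suc i) - z₀) ^ 2
    square i = begin
      (w (suc i) - w₀) ^ 2 * z (suc i) ^ 2 * z₀ ^ 2
        ≈⟨ solve 4 (λ w v z x → (w :- v) :^ 2 :* z :^ 2 :* x :^ 2 := (w :* z :* x :- v :* x :* z) :^ 2) refl (w (suc i)) w₀ (z (suc i)) z₀ ⟩
      (w (suc i) * z (suc i) * z₀ - w₀ * z₀ * z (suc i)) ^ 2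
        ≈⟨ ^-congˡ 2 (+-cong (trans (*-congʳ (wz≈1 (suc i))) (*-identityˡ _)) (-‿cong (trans (*-congʳ (wz≈1 zero)) (*-identityˡ _)))) ⟩
      (z₀ - z (suc i)) ^ 2
        ≈⟨ solve 2 (λ x z → (x :- z) :^ 2 := (z :- x) :^ 2) refl z₀ (z (suc i)) ⟩
      (z (suc i) - z₀) ^ 2 ∎

    differences : p ^ 2 * Z ^ 2 * (z₀ ^ 2) ^ n ≈ q ^ 2
    differences = begin
      p ^ 2 * Z ^ 2 * (z₀ ^ 2) ^ n
        ≈⟨ *-cong (*-cong (∏-^ (λ i → w (suc i) - w₀) 2) (∏-^ (z ∘ suc) 2)) (∏-replicate n) ⟨
      ∏ (λ i → (w (suc i) - w₀) ^ 2) * ∏ (λ i → z (suc i) ^ 2) * ∏ {n} (λ _ → z₀ ^ 2)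
        ≈⟨ *-congʳ (∏-distrib-* (λ i → (w (suc i) - w₀) ^ 2) (λ i → z (suc i) ^ 2)) ⟨
      ∏ (λ i → (w (suc i) - w₀) ^ 2 * z (suc i) ^ 2) * ∏ {n} (λ _ → z₀ ^ 2)
        ≈⟨ ∏-distrib-* (λ i → (w (suc i) - w₀) ^ 2 * z (suc i) ^ 2) (λ _ → z₀ ^ 2) ⟨
      ∏ (λ i → (w (suc i) - w₀) ^ 2 * z (suc i) ^ 2 * z₀ ^ 2)
        ≈⟨ ∏-cong square ⟩
      ∏ (λ i → (z (suc i) - z₀) ^ 2)
        ≈⟨ ∏-^ (λ i → z (suc i) - z₀) 2 ⟩
      q ^ 2 ∎

  ∏-inverse : ∀ {n} (w z : Fin n → Carrier) → (∀ i → w i * z i ≈ 1#) → ∏ w * ∏ z ≈ 1#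
  ∏-inverse {n} w z wz≈1 = trans (sym (∏-distrib-* w z)) (trans (∏-cong wz≈1) (trans (∏-replicate n) (1^ n)))

  module _ {n} (w z : Fin n → Carrier) (wz≈1 : ∀ i → w i * z i ≈ 1#) where

    -- This is the count behind 2n + 1. Of `Z` to the power 2n + 1, the even part `(Z ^ 2) ^ n`
    -- turns one V(w)² into Z² V(z)², so Z³ remains. It faces W³, namely W² from the prefactor and W
    -- from the confluent determinant. Two of each shift the Vandermonde exponents, and the last
    -- pair cancels as W Z = 1.
    confluent-shiftedVandermonde : ∏ (prefactor w z) * confluent n w ≈ shiftedVandermonde n z ^ 2 * shiftedVandermonde n w ^ 2
    confluent-shiftedVandermonde = begin
      ∏ (prefactor w z) * confluent n w
        ≈⟨ *-cong ∏-prefactor (confluent-vandermonde n w) ⟩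
      ((Z ^ 2) ^ n * Z * W ^ 2) * (W * Vw ^ 4)
        ≈⟨ solve 4 (λ Zn Z W V → (Zn :* Z :* W :^ 2) :* (W :* V :^ 4) := (V :^ 2 :* Zn) :* (Z :* W :^ 3 :* V :^ 2)) refl ((Z ^ 2) ^ n) Z W Vw ⟩
      (Vw ^ 2 * (Z ^ 2) ^ n) * (Z * W ^ 3 * Vw ^ 2)
        ≈⟨ *-congʳ (vandermonde-inverse w z wz≈1) ⟩
      (Z ^ 2 * Vz ^ 2) * (Z * W ^ 3 * Vw ^ 2)
        ≈⟨ solve 4 (λ Z W V U → (Z :^ 2 :* U :^ 2) :* (Z :* W :^ 3 :* V :^ 2) := (W :* Z) :* ((Z :* U) :^ 2 :* (W :* V) :^ 2)) refl Z W Vw Vz ⟩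
      (W * Z) * ((Z * Vz) ^ 2 * (W * Vw) ^ 2)
        ≈⟨ trans (*-congʳ (∏-inverse w z wz≈1)) (*-identityˡ _) ⟩
      (Z * Vz) ^ 2 * (W * Vw) ^ 2
        ≈⟨ *-cong (^-congˡ 2 (shiftedVandermonde-vandermonde z)) (^-congˡ 2 (shiftedVandermonde-vandermonde w)) ⟨
      shiftedVandermonde n z ^ 2 * shiftedVandermonde n w ^ 2 ∎
      where
      W = ∏ w
      Z = ∏ z
      Vw = vandermonde n w
      Vz = vandermonde n z
      ∏-prefactor : ∏ (prefactor w z) ≈ (Z ^ 2) ^ n * Z * W ^ 2
      ∏-prefactor = begin
        ∏ (prefactor w z)
          ≈⟨ ∏-distrib-* (λ i → z i ^ (2 ℕ.* n ℕ.+ 1)) (λ i → w i ^ 2) ⟩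
        ∏ (λ i → z i ^ (2 ℕ.* n ℕ.+ 1)) * ∏ (λ i → w i ^ 2)
          ≈⟨ *-cong (∏-^ z (2 ℕ.* n ℕ.+ 1)) (∏-^ w 2) ⟩
        Z ^ (2 ℕ.* n ℕ.+ 1) * W ^ 2
          ≈⟨ *-congʳ (^-homo-* Z (2 ℕ.* n) 1) ⟩
        Z ^ (2 ℕ.* n) * Z ^ 1 * W ^ 2
          ≈⟨ *-congʳ (*-cong (sym (^-assocʳ Z 2 n)) (*-identityʳ Z)) ⟩
        (Z ^ 2) ^ n * Z * W ^ 2 ∎

    private
      pairEntry-anti : ∀ i a b → pairEntry w z i b a ≈ - pairEntry w z i a b
      pairEntry-anti i a b = solve 5 (λ y a b p q → y :* ((a :- b) :* (q :* p)) := :- (y :* ((b :- a) :* (p :* q)))) refl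
        (prefactor w z i) (toℕ a · 1#) (toℕ b · 1#) (w i ^ toℕ a) (w i ^ toℕ b)

      pairEntry-diag : ∀ i a → pairEntry w z i a a ≈ 0#
      pairEntry-diag i a = solve 3 (λ y a p → y :* ((a :- a) :* p) := con 0ℤ) refl (prefactor w z i) (toℕ a · 1#) (w i ^ toℕ a * w i ^ toℕ a)

    -- The truncated entry and the prefactor times power times Euler derivative have the same
    -- antisymmetrization, namely `pairEntry`, so `pairDet` does not distinguish them.
    pairDet-above-pairEntry : pairDet n (λ i → above (pairEntry w z i)) ≈ shiftedVandermonde n z ^ 2 * shiftedVandermonde n w ^ 2
    pairDet-above-pairEntry = trans (pairDet-antisym λ i a b → trans (above-antisym (pairEntry w z i) (pairEntry-anti i) (pairEntry-diag i) a b) (pairEntry≈ i a b))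
      (trans (pairDet-scale (prefactor w z) (λ i a b → w i ^ toℕ a * eulerPowers (w i) (toℕ b))) confluent-shiftedVandermonde)
      where
      euler : ∀ v k → eulerPowers v k ≈ k · 1# * v ^ k
      euler v k = sym (trans (×-assoc-* k 1# (v ^ k)) (×-congʳ k (*-identityˡ _)))
      pairEntry≈ : ∀ i a b → pairEntry w z i a b ≈ prefactor w z i * (w i ^ toℕ a * eulerPowers (w i) (toℕ b))
                                  - prefactor w z i * (w i ^ toℕ b * eulerPowers (w i) (toℕ a))
      pairEntry≈ i a b = sym (trans (+-cong (*-congˡ (*-congˡ (euler (w i) (toℕ b)))) (-‿cong (*-congˡ (*-congˡ (euler (w i) (toℕ a))))))
        (solve 5 (λ y a b p q → y :* (p :* (b :* q)) :- y :* (q :* (a :* p)) := y :* ((b :- a) :* (p :* q))) refl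
          (prefactor w z i) (toℕ a · 1#) (toℕ b · 1#) (w i ^ toℕ a) (w i ^ toℕ b)))

    pairDet-pairEntry : pairDet n (pairEntry w z) ≈ (1# + 1#) ^ n * (shiftedVandermonde n z ^ 2 * shiftedVandermonde n w ^ 2)
    pairDet-pairEntry = begin
      pairDet n (pairEntry w z)
        ≈⟨ pairDet-antisym doubled ⟩
      pairDet n (λ i a b → (1# + 1#) * above (pairEntry w z i) a b)
        ≈⟨ pairDet-scale (λ _ → 1# + 1#) (λ i → above (pairEntry w z i)) ⟩
      ∏ {n} (λ _ → 1# + 1#) * pairDet n (λ i → above (pairEntry w z i))
        ≈⟨ *-cong (∏-replicate n) pairDet-above-pairEntry ⟩
      (1# + 1#) ^ n * (shiftedVandermonde n z ^ 2 * shiftedVandermonde n w ^ 2) ∎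
      where
      doubled : ∀ i a b → pairEntry w z i a b - pairEntry w z i b a ≈
                (1# + 1#) * above (pairEntry w z i) a b - (1# + 1#) * above (pairEntry w z i) b a
      doubled i a b = begin
        pairEntry w z i a b - pairEntry w z i b a         ≈⟨ +-congˡ (pairEntry-anti i b a) ⟨
        pairEntry w z i a b + pairEntry w z i a b         ≈⟨ +-cong (*-identityˡ _) (*-identityˡ _) ⟨
        1# * pairEntry w z i a b + 1# * pairEntry w z i a b   ≈⟨ distribʳ _ _ _ ⟨
        (1# + 1#) * pairEntry w z i a b           ≈⟨ *-congˡ (above-antisym (pairEntry w z i) (pairEntry-anti i) (pairEntry-diag i) a b) ⟨
        (1# + 1#) * (above (pairEntry w z i) a b - above (pairEntry w z i) b a)
          ≈⟨ solve 3 (λ t x y → t :* (x :- y) := t :* x :- t :* y) refl (1# + 1#) _ _ ⟩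
        (1# + 1#) * above (pairEntry w z i) a b - (1# + 1#) * above (pairEntry w z i) b a ∎

-- Monoid algebras

-- The monoid algebra K[M]: formal expressions, identified when every function
-- M → K, extended linearly, takes the same value on them.
module MonoidAlgebra {c ℓ m ℓm} (K : CommutativeRing c ℓ) (M : CommutativeMonoid m ℓm) where
  open CommutativeRing K hiding (zero)
  open CommutativeMonoid M using (_∙_; ε; ∙-cong; ∙-congˡ; ∙-congʳ; identityˡ; assoc; comm)
    renaming (Carrier to Exponent; _≈_ to _≈ᴹ_)
  open RingProperties ring using (-‿distribʳ-*; -‿distribˡ-*; -1*x≈-x)
  open AbelianGroupProperties +-abelianGroup using (⁻¹-∙-comm)
  open IntegerCoefficients K using (solve; _:=_; _:+_; _:*_; _:-_; :-_)

  infixl 6 _⊕_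
  infixl 7 _⊛_

  data Expr : Set (c ⊔ m) where
    mono    : Carrier → Exponent → Expr
    𝟘       : Expr
    _⊕_ _⊛_ : Expr → Expr → Expr
    ⊝_      : Expr → Expr

  -- An expression acts as the finitely supported measure that it denotes, and a product as a
  -- convolution; the ring laws become linearity and interchange of integrals, without normal forms
  -- for polynomials.
  ⟦_⟧ : Expr → (Exponent → Carrier) → Carrier
  ⟦ mono k x ⟧ g = k * g x
  ⟦ 𝟘 ⟧        g = 0#
  ⟦ p ⊕ q ⟧    g = ⟦ p ⟧ g + ⟦ q ⟧ g
  ⟦ p ⊛ q ⟧    g = ⟦ p ⟧ λ x → ⟦ q ⟧ λ y → g (x ∙ y)
  ⟦ ⊝ p ⟧      g = - ⟦ p ⟧ g

  Respects : (Exponent → Carrier) → Set (ℓ ⊔ m ⊔ ℓm)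
  Respects g = ∀ {x y} → x ≈ᴹ y → g x ≈ g y

  infix 4 _≋_
  record _≋_ (p q : Expr) : Set (c ⊔ ℓ ⊔ m ⊔ ℓm) where
    constructor equal
    field at : ∀ {g} → Respects g → ⟦ p ⟧ g ≈ ⟦ q ⟧ g
  open _≋_ public

  ⟦⟧-cong : ∀ p {g h} → (∀ x → g x ≈ h x) → ⟦ p ⟧ g ≈ ⟦ p ⟧ h
  ⟦⟧-cong (mono k x) g≈h = *-congˡ (g≈h x)
  ⟦⟧-cong 𝟘          g≈h = refl
  ⟦⟧-cong (p ⊕ q)    g≈h = +-cong (⟦⟧-cong p g≈h) (⟦⟧-cong q g≈h)
  ⟦⟧-cong (p ⊛ q)    g≈h = ⟦⟧-cong p λ x → ⟦⟧-cong q λ y → g≈h (x ∙ y)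
  ⟦⟧-cong (⊝ p)      g≈h = -‿cong (⟦⟧-cong p g≈h)

  ⟦⟧-scale : ∀ p k g → ⟦ p ⟧ (λ x → k * g x) ≈ k * ⟦ p ⟧ g
  ⟦⟧-scale (mono l x) k g = solve 3 (λ k l g → l :* (k :* g) := k :* (l :* g)) refl k l (g x)
  ⟦⟧-scale 𝟘          k g = sym (zeroʳ k)
  ⟦⟧-scale (p ⊕ q)    k g = trans (+-cong (⟦⟧-scale p k g) (⟦⟧-scale q k g)) (sym (distribˡ k _ _))
  ⟦⟧-scale (p ⊛ q)    k g = trans (⟦⟧-cong p λ x → ⟦⟧-scale q k (λ y → g (x ∙ y))) (⟦⟧-scale p k _)
  ⟦⟧-scale (⊝ p)      k g = trans (-‿cong (⟦⟧-scale p k g)) (-‿distribʳ-* k _)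

  ⟦⟧-+ : ∀ p g h → ⟦ p ⟧ (λ x → g x + h x) ≈ ⟦ p ⟧ g + ⟦ p ⟧ h
  ⟦⟧-+ (mono k x) g h = distribˡ k _ _
  ⟦⟧-+ 𝟘          g h = sym (+-identityˡ 0#)
  ⟦⟧-+ (p ⊕ q)    g h = trans (+-cong (⟦⟧-+ p g h) (⟦⟧-+ q g h))
    (solve 4 (λ a b c d → (a :+ b) :+ (c :+ d) := (a :+ c) :+ (b :+ d)) refl _ _ _ _)
  ⟦⟧-+ (p ⊛ q)    g h = trans (⟦⟧-cong p λ x → ⟦⟧-+ q (λ y → g (x ∙ y)) (λ y → h (x ∙ y))) (⟦⟧-+ p _ _)
  ⟦⟧-+ (⊝ p)      g h = trans (-‿cong (⟦⟧-+ p g h)) (sym (⁻¹-∙-comm _ _))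

  ⟦⟧-neg : ∀ p g → ⟦ p ⟧ (λ x → - g x) ≈ - ⟦ p ⟧ g
  ⟦⟧-neg p g = trans (⟦⟧-cong p λ x → sym (-1*x≈-x (g x))) (trans (⟦⟧-scale p (- 1#) g) (-1*x≈-x _))

  ⟦⟧-zero : ∀ p → ⟦ p ⟧ (λ _ → 0#) ≈ 0#
  ⟦⟧-zero p = trans (⟦⟧-cong p λ _ → sym (zeroˡ 0#)) (trans (⟦⟧-scale p 0# (λ _ → 0#)) (zeroˡ _))

  -- Fubini for finite sums, and the reason why `⊛` commutes. The integrand `h` is a general
  -- function of two variables because the induction through products leaves the form `g (x ∙ y)`.
  ⟦⟧-swap : ∀ p q (h : Exponent → Exponent → Carrier) →
    ⟦ p ⟧ (λ x → ⟦ q ⟧ (λ y → h x y)) ≈ ⟦ q ⟧ (λ y → ⟦ p ⟧ (λ x → h x y))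
  ⟦⟧-swap (mono k x) q h = sym (⟦⟧-scale q k (h x))
  ⟦⟧-swap 𝟘          q h = sym (⟦⟧-zero q)
  ⟦⟧-swap (p ⊕ p′)   q h = trans (+-cong (⟦⟧-swap p q h) (⟦⟧-swap p′ q h)) (sym (⟦⟧-+ q _ _))
  ⟦⟧-swap (p ⊛ p′)   q h = trans (⟦⟧-cong p λ x → ⟦⟧-swap p′ q (λ y → h (x ∙ y)))
                                 (⟦⟧-swap p q (λ x z → ⟦ p′ ⟧ (λ y → h (x ∙ y) z)))
  ⟦⟧-swap (⊝ p)      q h = trans (-‿cong (⟦⟧-swap p q h)) (sym (⟦⟧-neg q _))

  private
    ≋-isEquivalence : IsEquivalence _≋_
    ≋-isEquivalence = record
      { refl  = equal λ _ → refl
      ; sym   = λ p≋q → equal λ r → sym (p≋q .at r)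
      ; trans = λ p≋q q≋s → equal λ r → trans (p≋q .at r) (q≋s .at r)
      }

    ⊛-cong : ∀ {p p′ q q′} → p ≋ p′ → q ≋ q′ → (p ⊛ q) ≋ (p′ ⊛ q′)
    ⊛-cong {p} {p′} {q} {q′} p≋p′ q≋q′ = equal λ r → trans
      (⟦⟧-cong p λ x → q≋q′ .at (r ∘ ∙-congˡ))
      (p≋p′ .at λ x≈x′ → ⟦⟧-cong q′ λ y → r (∙-congʳ x≈x′))

    ⊛-comm : ∀ p q → (p ⊛ q) ≋ (q ⊛ p)
    ⊛-comm p q = equal λ {g} r → trans (⟦⟧-swap p q (λ x y → g (x ∙ y)))
      (⟦⟧-cong q λ y → ⟦⟧-cong p λ x → r (comm x y))

    ⊛-identityˡ : ∀ p → (mono 1# ε ⊛ p) ≋ p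
    ⊛-identityˡ p = equal λ r → trans (*-identityˡ _) (⟦⟧-cong p λ x → r (identityˡ x))

  open IsEquivalence ≋-isEquivalence using () renaming (trans to ≋-trans)

  commutativeRing : CommutativeRing (c ⊔ m) (c ⊔ ℓ ⊔ m ⊔ ℓm)
  commutativeRing = record
    { Carrier = Expr
    ; _≈_     = _≋_
    ; _+_     = _⊕_
    ; _*_     = _⊛_
    ; -_      = ⊝_
    ; 0#      = 𝟘
    ; 1#      = mono 1# ε
    ; isCommutativeRing = record
      { isRing = record
        { +-isAbelianGroup = record
          { isGroup = record
            { isMonoid = record
              { isSemigroup = record
                { isMagma = record
                  { isEquivalence = ≋-isEquivalence
                  ; ∙-cong = λ p≋p′ q≋q′ → equal λ r → +-cong (p≋p′ .at r) (q≋q′ .at r)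
                  }
                ; assoc = λ p q s → equal λ _ → +-assoc _ _ _
                }
              ; identity = (λ p → equal λ _ → +-identityˡ _) , (λ p → equal λ _ → +-identityʳ _)
              }
            ; inverse = (λ p → equal λ _ → -‿inverseˡ _) , (λ p → equal λ _ → -‿inverseʳ _)
            ; ⁻¹-cong = λ p≋q → equal λ r → -‿cong (p≋q .at r)
            }
          ; comm = λ p q → equal λ _ → +-comm _ _
          }
        ; *-cong = ⊛-cong
        ; *-assoc = λ p q s → equal λ r →
            ⟦⟧-cong p λ x → ⟦⟧-cong q λ y → ⟦⟧-cong s λ z → r (assoc x y z)
        ; *-identity = ⊛-identityˡ , λ p → ≋-trans (⊛-comm p _) (⊛-identityˡ p)
        ; distrib = (λ p q s → equal λ _ → ⟦⟧-+ p _ _) , (λ p q s → equal λ _ → refl)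
        }
      ; *-comm = ⊛-comm
      }
    }

  private
    module E = CommutativeRing commutativeRing
    module AExp = Exp E.commutativeSemiring
    module AMult = Mult E.semiring
    module A∑ = ListSums E.+-commutativeMonoid
    module A∏ = CommutativeMonoidSum E.*-commutativeMonoid
    module M∑ = CommutativeMonoidSum M
  open ListSums +-commutativeMonoid
  open Exp commutativeSemiring using (_^_)
  open Mult semiring using () renaming (_×_ to _·_)
  open CommutativeMonoidSum *-commutativeMonoid using () renaming (sum to ∏)
  open PermutationSums K using (∑-scale)

  mono-cong : ∀ {k l x y} → k ≈ l → x ≈ᴹ y → mono k x ≋ mono l y
  mono-cong k≈l x≈y = equal λ r → *-cong k≈l (r x≈y)

  mono-* : ∀ k l x y → mono (k * l) (x ∙ y) ≋ (mono k x ⊛ mono l y)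
  mono-* k l x y = equal λ _ → *-assoc k l _

  mono-coefficient : ∀ k l x → mono (k * l) x ≋ (mono k ε ⊛ mono l x)
  mono-coefficient k l x = E.trans (mono-cong refl (CommutativeMonoid.sym M (identityˡ x))) (mono-* k l ε x)

  mono-+ : ∀ k l x → mono (k + l) x ≋ (mono k x ⊕ mono l x)
  mono-+ k l x = equal λ _ → distribʳ _ k l

  mono-neg : ∀ k x → mono (- k) x ≋ (⊝ mono k x)
  mono-neg k x = equal λ _ → sym (-‿distribˡ-* k _)

  mono-zero : ∀ x → mono 0# x ≋ 𝟘
  mono-zero x = equal λ _ → zeroˡ _

  mono-^ : ∀ k e → mono (k ^ e) ε ≋ mono k ε AExp.^ e
  mono-^ k zero    = E.refl
  mono-^ k (suc e) = E.trans (mono-coefficient k (k ^ e) ε) (E.*-congˡ {mono k ε} (mono-^ k e))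

  mono-× : ∀ e → mono (e · 1#) ε ≋ (e AMult.× E.1#)
  mono-× zero    = mono-zero ε
  mono-× (suc e) = E.trans (mono-+ 1# (e · 1#) ε) (E.+-congˡ {E.1#} (mono-× e))

  mono-∏ : ∀ {N} (k : Fin N → Carrier) x → mono (∏ k) (M∑.sum x) ≋ A∏.sum (λ i → mono (k i) (x i))
  mono-∏ {zero}  k x = E.refl
  mono-∏ {suc N} k x = E.trans (mono-* (k zero) (∏ (k ∘ suc)) (x zero) (M∑.sum (x ∘ suc)))
    (E.*-congˡ {mono (k zero) (x zero)} (mono-∏ (k ∘ suc) (x ∘ suc)))

  ⟦∑⟧ : ∀ (xs : List X) f g → ⟦ A∑.∑ xs f ⟧ g ≡ ∑ xs (λ x → ⟦ f x ⟧ g)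
  ⟦∑⟧ []       f g = ≡.refl
  ⟦∑⟧ (x ∷ xs) f g = ≡.cong (λ s → ⟦ f x ⟧ g + s) (⟦∑⟧ xs f g)

  total : ∀ {k} → (X → Exponent) → Vec X k → Exponent
  total e []      = ε
  total e (x ∷ t) = e x ∙ total e t

  -- Expanding a power of a sum gives one monomial per tuple: this ties powers in the algebra to the
  -- sums over tuples of permutations in `Det` and `Pf`. It holds for every `g`, since `total` adds
  -- exponents in the very order in which the power multiplies.
  ⟦∑^⟧ : ∀ (xs : List X) (κ : X → Carrier) (e : X → Exponent) k g →
    ⟦ A∑.∑ xs (λ x → mono (κ x) (e x)) AExp.^ k ⟧ g ≈
    ∑ (tuples k xs) (λ t → ∏ (λ s → κ (lookup t s)) * g (total e t))
  ⟦∑^⟧ xs κ e zero    g = sym (+-identityʳ _)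
  ⟦∑^⟧ xs κ e (suc k) g = begin
    ⟦ S ⟧ (λ x → ⟦ S AExp.^ k ⟧ (λ y → g (x ∙ y)))
      ≡⟨ ⟦∑⟧ xs (λ x → mono (κ x) (e x)) _ ⟩
    ∑ xs (λ x → κ x * ⟦ S AExp.^ k ⟧ (λ y → g (e x ∙ y)))
      ≈⟨ ∑-cong xs (λ x → trans (*-congˡ (⟦∑^⟧ xs κ e k (λ y → g (e x ∙ y))))
           (trans (sym (∑-scale (tuples k xs) (κ x) _)) (∑-cong (tuples k xs) λ t → sym (*-assoc _ _ _)))) ⟩
    ∑ xs (λ x → ∑ (tuples k xs) (λ t → (κ x * ∏ (λ s → κ (lookup t s))) * g (e x ∙ total e t)))
      ≈⟨ ∑-cartesianProductWith _∷_ xs (tuples k xs) _ ⟨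
    ∑ (tuples (suc k) xs) (λ t → ∏ (λ s → κ (lookup t s)) * g (total e t)) ∎
    where
    open SetoidReasoning setoid
    S = A∑.∑ xs (λ x → mono (κ x) (e x))

-- Exponent vectors

private
  module ℤ-Sum = CommutativeMonoidSum ℤₚ.+-0-commutativeMonoid

single : Fin N → ℤ → Fin N → ℤ
single zero    k zero    = k
single zero    k (suc j) = 0ℤ
single (suc i) k zero    = 0ℤ
single (suc i) k (suc j) = single i k j

single-zero : (i j : Fin N) → single i 0ℤ j ≡ 0ℤ
single-zero zero    zero    = ≡.refl
single-zero zero    (suc j) = ≡.refl
single-zero (suc i) zero    = ≡.refl
single-zero (suc i) (suc j) = single-zero i j

single-+ : ∀ (i : Fin N) k l j → single i (k ℤ.+ l) j ≡ single i k j ℤ.+ single i l j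
single-+ zero    k l zero    = ≡.refl
single-+ zero    k l (suc j) = ≡.refl
single-+ (suc i) k l zero    = ≡.refl
single-+ (suc i) k l (suc j) = single-+ i k l j

sum-single : ∀ (k : Fin N → ℤ) j → ℤ-Sum.sum (λ i → single i (k i) j) ≡ k j
sum-single {suc N} k zero    = ≡.trans (≡.cong (ℤ._+_ (k zero)) (ℤ-Sum.sum-replicate-zero N)) (ℤₚ.+-identityʳ _)
sum-single {suc N} k (suc j) = ≡.trans (ℤₚ.+-identityˡ _) (sum-single (k ∘ suc) j)

ℤ^ : ℕ → CommutativeMonoid _ _
ℤ^ n = Pointwise.commutativeMonoid (Fin n) ℤₚ.+-0-commutativeMonoid

sum-apply : ∀ {n} (x : Fin N → Fin n → ℤ) j → CommutativeMonoidSum.sum (ℤ^ n) x j ≡ ℤ-Sum.sum (λ i → x i j)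
sum-apply {zero}  x j = ≡.refl
sum-apply {suc N} x j = ≡.cong (ℤ._+_ (x zero j)) (sum-apply (x ∘ suc) j)

take-map-++ : ∀ {j k} (f : X → Y) (t : Vec X j) (u : Vec X k) → take j (Vec.map f (t ++ u)) ≡ Vec.map f t
take-map-++ f []      u = ≡.refl
take-map-++ f (x ∷ t) u = ≡.cong (f x ∷_) (take-map-++ f t u)

drop-map-++ : ∀ {j k} (f : X → Y) (t : Vec X j) (u : Vec X k) → drop j (Vec.map f (t ++ u)) ≡ Vec.map f u
drop-map-++ f []      u = ≡.refl
drop-map-++ f (x ∷ t) u = drop-map-++ f t u

private
  regroup : ∀ x a b y s → (x ℤ.- a ℤ.- b) ℤ.+ (y ℤ.- s) ≡ (x ℤ.+ y) ℤ.- (a ℤ.+ (b ℤ.+ s))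
  regroup = solve 5 (λ x a b y s → (x :- a :- b) :+ (y :- s) := (x :+ y) :- (a :+ (b :+ s))) ≡.refl
    where open +-*-Solver using (solve; _:+_; _:-_; _:=_)

-- Hyperdeterminant and hyperpfaffian as values of the weight functional

module Toeplitz {c ℓ} (𝕂 : Scalars c ℓ) (n : ℕ) (d : ℤ → Scalars.Carrier 𝕂) where
  open Scalars 𝕂 using (commutativeRing; recip; recip-inverse; ι; _·_)
  open CommutativeRing commutativeRing hiding (zero)
  open Hyper 𝕂
  open MonoidAlgebra commutativeRing (ℤ^ n) renaming (commutativeRing to algebra)
  open Exp commutativeSemiring using (_^_)
  open Mult semiring using (×1-homo-*)
  open IntegerCoefficients commutativeRing using (fromℤ; fromℤ-⊖; solve; _:=_; _:*_)
  open CommutativeMonoidSum *-commutativeMonoid using ()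
    renaming (sum-cong-≋ to ∏-cong; ∑-distrib-+ to ∏-distrib-*; ∑-comm to ∏-comm; sum-replicate to ∏-replicate)
  open ListSums +-commutativeMonoid using (∑-cong; ∑-cartesianProductWith)
  open PermutationSums commutativeRing using (∑-scale)
  open Determinants commutativeRing using (1^)
  private
    module E = CommutativeRing algebra
    module EExp = Exp E.commutativeSemiring
    module EMult = Mult E.semiring
    module E∑ = ListSums E.+-commutativeMonoid
    module E∏ = CommutativeMonoidSum E.*-commutativeMonoid
    module ED = Determinants algebra
    module EP = PermutationSums algebra
    module ES = IntegerCoefficients algebra
    module E-Reasoning = SetoidReasoning E.setoid
    0ᴹ = CommutativeMonoid.ε (ℤ^ n)

  character : Fin n → ℤ → Expr
  character i k = mono 1# (single i k)

  -- Ring powers have natural exponents, so negative powers of zᵢ are powers of a second element wᵢ;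
  -- the relation wᵢ zᵢ = 1 is all that the determinant identities need.
  z w : Fin n → Expr
  z i = character i (+ 1)
  w i = character i (-[1+ 0 ])

  character-+ : ∀ i k l → character i (k ℤ.+ l) ≋ (character i k ⊛ character i l)
  character-+ i k l = E.trans (mono-cong (sym (*-identityˡ 1#)) (single-+ i k l)) (mono-* 1# 1# (single i k) (single i l))

  character-zero : ∀ i → character i 0ℤ ≋ E.1#
  character-zero i = mono-cong refl (single-zero i)

  z^ : ∀ i k → character i (+ k) ≋ z i EExp.^ k
  z^ i zero    = character-zero i
  z^ i (suc k) = E.trans (character-+ i (+ 1) (+ k)) (E.*-congˡ {z i} (z^ i k))

  w^ : ∀ i k → character i (ℤ.- (+ k)) ≋ w i EExp.^ k
  w^ i zero    = character-zero i
  w^ i (suc k) = E.trans (E.trans (mono-cong refl (λ j → ≡.cong (λ k → single i k j) (≡.sym (neg-suc k)))) (character-+ i -[1+ 0 ] (ℤ.- (+ k))))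
    (E.*-congˡ {w i} (w^ i k))
    where
    neg-suc : ∀ k → -[1+ 0 ] ℤ.+ (ℤ.- (+ k)) ≡ ℤ.- (+ suc k)
    neg-suc k = ≡.sym (ℤₚ.neg-distrib-+ (+ 1) (+ k))

  wz≈1 : ∀ i → (w i ⊛ z i) ≋ E.1#
  wz≈1 i = E.trans (E.sym (character-+ i -[1+ 0 ] (+ 1))) (character-zero i)

  mono-∏-single : ∀ (κ : Fin n → Carrier) x → mono (∏ κ) x ≋ E∏.sum (λ i → mono (κ i) (single i (x i)))
  mono-∏-single κ x = E.trans
    (mono-cong refl (λ j → ≡.trans (≡.sym (sum-single x j)) (≡.sym (sum-apply (λ i → single i (x i)) j))))
    (mono-∏ κ (λ i → single i (x i)))

  mono-sgn : ∀ {N} (σ : Permutation′ N) → mono (sgn σ) 0ᴹ ≋ EP.sign σ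
  mono-sgn σ = E.trans (mono-^ (- 1#) (inversions σ)) (EExp.^-congˡ (inversions σ) (mono-neg 1# 0ᴹ))

  -- Moves sign and coefficients from the scalars into the algebra and splits the monomial by
  -- coordinates, as the signed sums of `PermutationSums` require.
  signed : ∀ {N} (σ : Permutation′ N) (κ : Fin n → Carrier) x →
    mono (sgn σ * ∏ κ) x ≋ (EP.sign σ ⊛ E∏.sum (λ i → mono (κ i) (single i (x i))))
  signed σ κ x = E.trans (mono-coefficient (sgn σ) (∏ κ) x) (E.*-cong (mono-sgn σ) (mono-∏-single κ x))

  signed-1 : ∀ {N} (σ : Permutation′ N) x →
    mono (sgn σ) x ≋ (EP.sign σ ⊛ E∏.sum (λ i → character i (x i)))
  signed-1 σ x = E.trans (mono-cong (sym (trans (*-congˡ (trans (∏-replicate n) (1^ n))) (*-identityʳ _))) (λ _ → ≡.refl))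
    (signed σ (λ _ → 1#) x)

  ascending descending : Permutation′ n → Fin n → ℤ
  ascending  σ i = idx (σ ⟨$⟩ʳ i)
  descending σ i = ℤ.- idx (σ ⟨$⟩ʳ i)

  𝐕 : (Permutation′ n → Fin n → ℤ) → Expr
  𝐕 e = E∑.∑ (perms n) (λ σ → mono (sgn σ) (e σ))

  𝐕-ascending : 𝐕 ascending ≋ EP.shiftedVandermonde n z
  𝐕-ascending = E.trans
    (E∑.∑-cong (perms n) λ σ → E.trans (signed-1 σ (ascending σ))
      (E.*-congˡ {EP.sign σ} (E∏.sum-cong-≋ λ i → z^ i (suc (toℕ (σ ⟨$⟩ʳ i))))))
    (EP.∑-perms-det (λ i l → z i EExp.^ suc (toℕ l)))

  𝐕-descending : 𝐕 descending ≋ EP.shiftedVandermonde n w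
  𝐕-descending = E.trans
    (E∑.∑-cong (perms n) λ σ → E.trans (signed-1 σ (descending σ))
      (E.*-congˡ {EP.sign σ} (E∏.sum-cong-≋ λ i → w^ i (suc (toℕ (σ ⟨$⟩ʳ i))))))
    (EP.∑-perms-det (λ i l → w i EExp.^ suc (toℕ l)))

  pairExponent : Permutation′ (n ℕ.* 2) → Fin n → ℤ
  pairExponent σ i = + (2 ℕ.* n ℕ.+ 1) ℤ.- idx (σ ⟨$⟩ʳ odd i) ℤ.- idx (σ ⟨$⟩ʳ even i)

  pairDifference : Permutation′ (n ℕ.* 2) → Fin n → Carrier
  pairDifference σ i = ι (idx (σ ⟨$⟩ʳ even i) ℤ.- idx (σ ⟨$⟩ʳ odd i))

  𝐏 : List (Permutation′ (n ℕ.* 2)) → Expr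
  𝐏 σs = E∑.∑ σs (λ σ → mono (sgn σ * ∏ (pairDifference σ)) (pairExponent σ))

  ι≡fromℤ : ∀ k → ι k ≡ fromℤ k
  ι≡fromℤ (+ k)    = ≡.refl
  ι≡fromℤ -[1+ k ] = ≡.refl

  entry : ∀ i (a b : Fin (n ℕ.* 2)) →
    mono (ι (idx b ℤ.- idx a)) (single i (+ (2 ℕ.* n ℕ.+ 1) ℤ.- idx a ℤ.- idx b)) ≋ EP.pairEntry w z i a b
  entry i a b = begin
    mono (ι (idx b ℤ.- idx a)) (single i (+ 2n+1 ℤ.- idx a ℤ.- idx b))
      ≈⟨ mono-cong (sym (*-identityʳ _)) (λ _ → ≡.refl) ⟩
    mono (ι (idx b ℤ.- idx a) * 1#) (single i (+ 2n+1 ℤ.- idx a ℤ.- idx b))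
      ≈⟨ mono-coefficient _ 1# _ ⟩
    mono (ι (idx b ℤ.- idx a)) 0ᴹ ⊛ character i (+ 2n+1 ℤ.- idx a ℤ.- idx b)
      ≈⟨ E.*-cong difference exponent ⟩
    δ ⊛ ((z i EExp.^ 2n+1 ⊛ w i EExp.^ suc (toℕ a)) ⊛ w i EExp.^ suc (toℕ b))
      ≈⟨ E.*-congˡ {δ} (E.*-congʳ (E.*-congˡ {z i EExp.^ 2n+1} E.refl)) ⟩
    δ ⊛ ((z i EExp.^ 2n+1 ⊛ (w i ⊛ w i EExp.^ toℕ a)) ⊛ (w i ⊛ w i EExp.^ toℕ b))
      ≈⟨ ES.solve 5 (λ d z w p q → d ES.:* ((z ES.:* (w ES.:* p)) ES.:* (w ES.:* q)) ES.:= (z ES.:* w ES.:^ 2) ES.:* (d ES.:* (p ES.:* q)))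
           E.refl δ (z i EExp.^ 2n+1) (w i) (w i EExp.^ toℕ a) (w i EExp.^ toℕ b) ⟩
    EP.pairEntry w z i a b ∎
    where
    open E-Reasoning
    2n+1 = 2 ℕ.* n ℕ.+ 1
    δ = toℕ b EMult.× E.1# E.- toℕ a EMult.× E.1#
    difference : mono (ι (idx b ℤ.- idx a)) 0ᴹ ≋ δ
    difference = E.trans
      (mono-cong (trans (reflexive (≡.trans (≡.cong ι (ℤₚ.[1+m]⊖[1+n]≡m⊖n (toℕ b) (toℕ a))) (ι≡fromℤ (toℕ b ℤ.⊖ toℕ a)))) (fromℤ-⊖ (toℕ b) (toℕ a))) (λ _ → ≡.refl))
      (E.trans (mono-+ _ _ 0ᴹ) (E.+-cong (mono-× (toℕ b)) (E.trans (mono-neg _ 0ᴹ) (E.-‿cong (mono-× (toℕ a))))))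
    exponent : character i (+ 2n+1 ℤ.- idx a ℤ.- idx b) ≋ ((z i EExp.^ 2n+1 ⊛ w i EExp.^ suc (toℕ a)) ⊛ w i EExp.^ suc (toℕ b))
    exponent = E.trans (character-+ i (+ 2n+1 ℤ.- idx a) (ℤ.- idx b)) (E.*-cong
      (E.trans (character-+ i (+ 2n+1) (ℤ.- idx a)) (E.*-cong (z^ i 2n+1) (w^ i (suc (toℕ a))))) (w^ i (suc (toℕ b))))

  𝐏-sign : ∀ σs → 𝐏 σs ≋ E∑.∑ σs (λ σ → EP.sign σ ⊛ E∏.sum (λ i → EP.pairEntry w z i (σ ⟨$⟩ʳ odd i) (σ ⟨$⟩ʳ even i)))
  𝐏-sign σs = E∑.∑-cong σs λ σ → E.trans (signed σ (pairDifference σ) (pairExponent σ))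
    (E.*-congˡ {EP.sign σ} (E∏.sum-cong-≋ λ i → entry i (σ ⟨$⟩ʳ odd i) (σ ⟨$⟩ʳ even i)))

  𝐕² : Expr
  𝐕² = 𝐕 ascending EExp.^ 2 ⊛ 𝐕 descending EExp.^ 2

  𝐕²≋shiftedVandermonde : 𝐕² ≋ (EP.shiftedVandermonde n z EExp.^ 2 ⊛ EP.shiftedVandermonde n w EExp.^ 2)
  𝐕²≋shiftedVandermonde = E.*-cong (EExp.^-congˡ 2 𝐕-ascending) (EExp.^-congˡ 2 𝐕-descending)

  𝐏-𝔈 : 𝐏 (𝔈 n) ≋ 𝐕²
  𝐏-𝔈 = E.trans (𝐏-sign (𝔈 n)) (E.trans (EP.∑-𝔈-pairDet (EP.pairEntry w z))
    (E.trans (EP.pairDet-above-pairEntry w z wz≈1) (E.sym 𝐕²≋shiftedVandermonde)))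

  𝐏-perms : 𝐏 (perms (n ℕ.* 2)) ≋ (mono ((1# + 1#) ^ n) 0ᴹ ⊛ 𝐕²)
  𝐏-perms = E.trans (𝐏-sign (perms (n ℕ.* 2))) (E.trans (EP.∑-perms-pairDet (EP.pairEntry w z))
    (E.trans (EP.pairDet-pairEntry w z wz≈1) (E.*-cong two (E.sym 𝐕²≋shiftedVandermonde))))
    where
    two : ((E.1# E.+ E.1#) EExp.^ n) ≋ mono ((1# + 1#) ^ n) 0ᴹ
    two = E.sym (E.trans (mono-^ (1# + 1#) n) (EExp.^-congˡ n (mono-+ 1# 1# 0ᴹ)))

  weight : (Fin n → ℤ) → Carrier
  weight k = ∏ (λ i → d (k i))

  weight-respects : Respects weight
  weight-respects k≗l = ∏-cong λ i → reflexive (≡.cong d (k≗l i))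

  total-ascending : ∀ {k} (t : Vec (Permutation′ n) k) i →
    total ascending t i ≡ ∑idx (Vec.map (_⟨$⟩ʳ i) t)
  total-ascending []      i = ≡.refl
  total-ascending (σ ∷ t) i = ≡.cong (ℤ._+_ (idx (σ ⟨$⟩ʳ i))) (total-ascending t i)

  total-descending : ∀ {k} (t : Vec (Permutation′ n) k) i →
    total descending t i ≡ ℤ.- ∑idx (Vec.map (_⟨$⟩ʳ i) t)
  total-descending []      i = ≡.refl
  total-descending (σ ∷ t) i = ≡.trans (≡.cong (ℤ._+_ (ℤ.- idx (σ ⟨$⟩ʳ i))) (total-descending t i))
    (≡.sym (ℤₚ.neg-distrib-+ (idx (σ ⟨$⟩ʳ i)) (∑idx (Vec.map (_⟨$⟩ʳ i) t))))

  ∑-tuples-++ : ∀ j {k} (xs : List X) (f : Vec X (j ℕ.+ k) → Carrier) →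
    ∑ (tuples (j ℕ.+ k) xs) f ≈ ∑ (tuples j xs) (λ t → ∑ (tuples k xs) (λ u → f (t ++ u)))
  ∑-tuples-++ zero    xs f = sym (+-identityʳ _)
  ∑-tuples-++ (suc j) {k} xs f = begin
    ∑ (tuples (suc j ℕ.+ k) xs) f
      ≈⟨ ∑-cartesianProductWith _∷_ xs (tuples (j ℕ.+ k) xs) f ⟩
    ∑ xs (λ x → ∑ (tuples (j ℕ.+ k) xs) (λ v → f (x ∷ v)))
      ≈⟨ ∑-cong xs (λ x → ∑-tuples-++ j xs (λ v → f (x ∷ v))) ⟩
    ∑ xs (λ x → ∑ (tuples j xs) (λ t → ∑ (tuples k xs) (λ u → f (x ∷ t ++ u))))
      ≈⟨ ∑-cartesianProductWith _∷_ xs (tuples j xs) (λ t → ∑ (tuples k xs) (λ u → f (t ++ u))) ⟨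
    ∑ (tuples (suc j) xs) (λ t → ∑ (tuples k xs) (λ u → f (t ++ u))) ∎
    where open SetoidReasoning setoid

  ∏-lookup-++ : ∀ {j k} (f : X → Carrier) (t : Vec X j) (u : Vec X k) →
    ∏ (λ s → f (lookup (t ++ u) s)) ≈ ∏ (λ s → f (lookup t s)) * ∏ (λ s → f (lookup u s))
  ∏-lookup-++ f []      u = sym (*-identityˡ _)
  ∏-lookup-++ f (x ∷ t) u = trans (*-congˡ (∏-lookup-++ f t u)) (sym (*-assoc _ _ _))

  -- In the Toeplitz index the first p permutations enter with plus and the last p with minus;
  -- cutting each tuple in the middle separates the factors V(z) from the factors V(z⁻¹).
  D-𝐕 : ∀ p → D p n d ≈ 1/ n ! * ⟦ 𝐕 ascending EExp.^ p ⊛ 𝐕 descending EExp.^ p ⟧ weight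
  D-𝐕 p = *-congˡ (begin
    ∑ (tuples (p ℕ.+ q) (perms n)) term
      ≈⟨ ∑-tuples-++ p (perms n) term ⟩
    ∑ (tuples p (perms n)) (λ t → ∑ (tuples q (perms n)) (λ u → term (t ++ u)))
      ≈⟨ ∑-cong (tuples p (perms n)) (λ t → trans (∑-cong (tuples q (perms n)) (split t)) (∑-scale (tuples q (perms n)) (signs t) _)) ⟩
    ∑ (tuples p (perms n)) (λ t → signs t * ∑ (tuples q (perms n)) (λ u → signs u * weight (total ascending t ∙ total descending u)))
      ≈⟨ ∑-cong (tuples p (perms n)) (λ t → *-congˡ (⟦∑^⟧ (perms n) sgn descending q (λ y → weight (total ascending t ∙ y)))) ⟨
    ∑ (tuples p (perms n)) (λ t → signs t * ⟦ 𝐕 descending EExp.^ q ⟧ (λ y → weight (total ascending t ∙ y)))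
      ≈⟨ ⟦∑^⟧ (perms n) sgn ascending p _ ⟨
    ⟦ 𝐕 ascending EExp.^ p ⊛ 𝐕 descending EExp.^ q ⟧ weight
      ≡⟨ ≡.cong (λ q → ⟦ 𝐕 ascending EExp.^ p ⊛ 𝐕 descending EExp.^ q ⟧ weight) (ℕₚ.+-identityʳ p) ⟩
    ⟦ 𝐕 ascending EExp.^ p ⊛ 𝐕 descending EExp.^ p ⟧ weight ∎)
    where
    open SetoidReasoning setoid
    open CommutativeMonoid (ℤ^ n) using (_∙_)
    -- `2 ℕ.* p` computes to `p ℕ.+ (p ℕ.+ 0)`, so this is the length of the second half.
    q = p ℕ.+ 0
    signs : ∀ {k} → Vec (Permutation′ n) k → Carrier
    signs t = ∏ (λ s → sgn (lookup t s))
    term : Vec (Permutation′ n) (p ℕ.+ q) → Carrier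
    term σ = signs σ * ∏ {n} (λ i → d (∑idx (take p (Vec.map (_⟨$⟩ʳ i) σ)) ℤ.- ∑idx (drop p (Vec.map (_⟨$⟩ʳ i) σ))))
    split : ∀ t u → term (t ++ u) ≈ signs t * (signs u * weight (total ascending t ∙ total descending u))
    split t u = trans (*-cong (∏-lookup-++ sgn t u) (∏-cong λ i → reflexive (≡.cong d (≡.cong₂ ℤ._+_
        (≡.trans (≡.cong ∑idx (take-map-++ (_⟨$⟩ʳ i) t u)) (≡.sym (total-ascending t i)))
        (≡.trans (≡.cong (λ v → ℤ.- ∑idx v) (drop-map-++ (_⟨$⟩ʳ i) t u)) (≡.sym (total-descending u i)))))))
      (*-assoc _ _ _)

  pairs : ∀ {m} → Vec (Permutation′ (n ℕ.* 2)) m → Fin n → Vec (Fin (n ℕ.* 2)) (m ℕ.* 2)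
  pairs σ i = Vec.concat (Vec.map (λ τ → (τ ⟨$⟩ʳ odd i) ∷ (τ ⟨$⟩ʳ even i) ∷ []) σ)

  lookup-odd : ∀ {m} (σ : Vec (Permutation′ (n ℕ.* 2)) m) i s → lookup (pairs σ i) (odd s) ≡ lookup σ s ⟨$⟩ʳ odd i
  lookup-odd (τ ∷ σ) i zero    = ≡.refl
  lookup-odd (τ ∷ σ) i (suc s) = lookup-odd σ i s

  lookup-even : ∀ {m} (σ : Vec (Permutation′ (n ℕ.* 2)) m) i s → lookup (pairs σ i) (even s) ≡ lookup σ s ⟨$⟩ʳ even i
  lookup-even (τ ∷ σ) i zero    = ≡.refl
  lookup-even (τ ∷ σ) i (suc s) = lookup-even σ i s

  -- The constant (2n + 1)m is the sum of m copies of 2n + 1, one for each factor P.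
  total-pairExponent : ∀ {m} (σ : Vec (Permutation′ (n ℕ.* 2)) m) i →
    total pairExponent σ i ≡ + ((2 ℕ.* n ℕ.+ 1) ℕ.* m) ℤ.- ∑idx (pairs σ i)
  total-pairExponent []          i = ≡.cong (λ k → + k ℤ.- 0ℤ) (≡.sym (ℕₚ.*-zeroʳ (2 ℕ.* n ℕ.+ 1)))
  total-pairExponent {suc m} (τ ∷ σ) i = begin
    (+ A ℤ.- a ℤ.- b) ℤ.+ total pairExponent σ i
      ≡⟨ ≡.cong (ℤ._+_ (+ A ℤ.- a ℤ.- b)) (total-pairExponent σ i) ⟩
    (+ A ℤ.- a ℤ.- b) ℤ.+ (+ (A ℕ.* m) ℤ.- S)
      ≡⟨ regroup (+ A) a b (+ (A ℕ.* m)) S ⟩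
    + (A ℕ.+ A ℕ.* m) ℤ.- ∑idx (pairs (τ ∷ σ) i)
      ≡⟨ ≡.cong (λ k → + k ℤ.- ∑idx (pairs (τ ∷ σ) i)) (ℕₚ.*-suc A m) ⟨
    + (A ℕ.* suc m) ℤ.- ∑idx (pairs (τ ∷ σ) i) ∎
    where
    open ≡.≡-Reasoning
    A = 2 ℕ.* n ℕ.+ 1
    a = idx (τ ⟨$⟩ʳ odd i)
    b = idx (τ ⟨$⟩ʳ even i)
    S = ∑idx (pairs σ i)

  -- The array collects the differences by position i, the power of P by permutation s;
  -- interchanging the two products reconciles them.
  Pf-𝐏 : ∀ m → 
    Pf m n (λ i → ∏ {m} (λ s → ι (idx (lookup i (even s)) ℤ.- idx (lookup i (odd s))))
                  * d (+ ((2 ℕ.* n ℕ.+ 1) ℕ.* m) ℤ.- ∑idx i))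
    ≈ 1/ n ! * ⟦ 𝐏 (𝔈 n) EExp.^ m ⟧ weight
  Pf-𝐏 m = *-congˡ (trans (∑-cong (tuples m (𝔈 n)) term)
    (sym (⟦∑^⟧ (𝔈 n) (λ σ → sgn σ * ∏ (pairDifference σ)) pairExponent m weight)))
    where
    open SetoidReasoning setoid
    term : ∀ σ →
      ∏ (λ s → sgn (lookup σ s)) * ∏ {n} (λ i →
        ∏ {m} (λ s → ι (idx (lookup (pairs σ i) (even s)) ℤ.- idx (lookup (pairs σ i) (odd s))))
          * d (+ ((2 ℕ.* n ℕ.+ 1) ℕ.* m) ℤ.- ∑idx (pairs σ i)))
      ≈ ∏ (λ s → sgn (lookup σ s) * ∏ (pairDifference (lookup σ s))) * weight (total pairExponent σ)
    term σ = begin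
      signs * ∏ {n} (λ i →
        ∏ {m} (λ s → ι (idx (lookup (pairs σ i) (even s)) ℤ.- idx (lookup (pairs σ i) (odd s))))
          * d (+ ((2 ℕ.* n ℕ.+ 1) ℕ.* m) ℤ.- ∑idx (pairs σ i)))
        ≈⟨ *-congˡ (∏-cong λ i → *-cong
             (∏-cong {m} λ s → reflexive (≡.cong₂ (λ a b → ι (idx a ℤ.- idx b)) (lookup-even σ i s) (lookup-odd σ i s)))
             (reflexive (≡.cong d (≡.sym (total-pairExponent σ i))))) ⟩
      signs * ∏ {n} (λ i → ∏ {m} (λ s → pairDifference (lookup σ s) i) * d (total pairExponent σ i))
        ≈⟨ *-congˡ (∏-distrib-* (λ i → ∏ {m} (λ s → pairDifference (lookup σ s) i)) (λ i → d (total pairExponent σ i))) ⟩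
      signs * (∏ {n} (λ i → ∏ {m} (λ s → pairDifference (lookup σ s) i)) * weight (total pairExponent σ))
        ≈⟨ *-congˡ (*-congʳ (∏-comm (λ i s → pairDifference (lookup σ s) i))) ⟩
      signs * (∏ {m} (λ s → ∏ (pairDifference (lookup σ s))) * weight (total pairExponent σ))
        ≈⟨ *-assoc _ _ _ ⟨
      signs * ∏ {m} (λ s → ∏ (pairDifference (lookup σ s))) * weight (total pairExponent σ)
        ≈⟨ *-congʳ (∏-distrib-* (λ s → sgn (lookup σ s)) (λ s → ∏ (pairDifference (lookup σ s)))) ⟨
      ∏ (λ s → sgn (lookup σ s) * ∏ (pairDifference (lookup σ s))) * weight (total pairExponent σ) ∎
      where signs = ∏ (λ s → sgn (lookup σ s))

  -- Only `recip-inverse` is known of `recip`, so the quotient is found by inserting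
  -- `(k · 1#) * recip k`. It lets the normalization of `pf` absorb 2ⁿ.
  recip-cancel : ∀ j k .{{_ : NonZero j}} .{{_ : NonZero k}} .{{_ : NonZero (j ℕ.* k)}} →
    recip (j ℕ.* k) * (j · 1#) ≈ recip k
  recip-cancel j k = begin
    recip (j ℕ.* k) * (j · 1#)
      ≈⟨ *-identityʳ _ ⟨
    recip (j ℕ.* k) * (j · 1#) * 1#
      ≈⟨ *-congˡ (recip-inverse k) ⟨
    recip (j ℕ.* k) * (j · 1#) * ((k · 1#) * recip k)
      ≈⟨ solve 4 (λ r j k s → r :* j :* (k :* s) := (j :* k) :* r :* s) refl _ _ _ _ ⟩
    (j · 1#) * (k · 1#) * recip (j ℕ.* k) * recip k
      ≈⟨ *-congʳ (*-congʳ (×1-homo-* j k)) ⟨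
    ((j ℕ.* k) · 1#) * recip (j ℕ.* k) * recip k
      ≈⟨ *-congʳ (recip-inverse (j ℕ.* k)) ⟩
    1# * recip k
      ≈⟨ *-identityˡ _ ⟩
    recip k ∎
    where open SetoidReasoning setoid

  2^ : ∀ k → (1# + 1#) ^ k ≈ (2 ℕ.^ k) · 1#
  2^ zero    = sym (+-identityʳ 1#)
  2^ (suc k) = trans (*-cong (+-congˡ (sym (+-identityʳ 1#))) (2^ k)) (sym (×1-homo-* 2 (2 ℕ.^ k)))

  -- `pf` sums over all of 𝔖₂ₙ, so the comparison uses `𝐏-perms`, whose factor 2ⁿ reduces 1/(2ⁿ n!)
  -- to the 1/n! of the hyperdeterminant.
  pf-𝐏 : pf n (λ i j → ι (idx j ℤ.- idx i) * d (+ (2 ℕ.* n ℕ.+ 1) ℤ.- idx i ℤ.- idx j))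
       ≈ 1/ n ! * ⟦ 𝐕² ⟧ weight
  pf-𝐏 = begin
    r * ∑ (perms (n ℕ.* 2)) (λ σ → sgn σ * ∏ {n} (λ i → pairDifference σ i * d (pairExponent σ i)))
      ≈⟨ *-congˡ (∑-cong (perms (n ℕ.* 2)) λ σ → trans
           (*-congˡ (∏-distrib-* (pairDifference σ) (λ i → d (pairExponent σ i)))) (sym (*-assoc _ _ _))) ⟩
    r * ∑ (perms (n ℕ.* 2)) (λ σ → (sgn σ * ∏ (pairDifference σ)) * weight (pairExponent σ))
      ≡⟨ ≡.cong (r *_) (⟦∑⟧ (perms (n ℕ.* 2)) (λ σ → mono (sgn σ * ∏ (pairDifference σ)) (pairExponent σ)) weight) ⟨
    r * ⟦ 𝐏 (perms (n ℕ.* 2)) ⟧ weight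
      ≈⟨ *-congˡ (𝐏-perms .at weight-respects) ⟩
    r * ((1# + 1#) ^ n * ⟦ 𝐕² ⟧ (λ x → weight (0ᴹ ∙ x)))
      ≈⟨ *-assoc _ _ _ ⟨
    r * (1# + 1#) ^ n * ⟦ 𝐕² ⟧ (λ x → weight (0ᴹ ∙ x))
      ≈⟨ *-cong (trans (*-congˡ (2^ n)) (recip-cancel (2 ℕ.^ n) (n !) {{ℕₚ.m^n≢0 2 n}} {{n ℕₚ.!≢0}} {{ne}}))
           (⟦⟧-cong 𝐕² λ x → weight-respects {0ᴹ ∙ x} {x} (λ i → ℤₚ.+-identityˡ (x i))) ⟩
    1/ n ! * ⟦ 𝐕² ⟧ weight ∎
    where
    open SetoidReasoning setoid
    open CommutativeMonoid (ℤ^ n) using (_∙_)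
    ne : NonZero (2 ℕ.^ n ℕ.* n !)
    ne = ℕₚ.m*n≢0 (2 ℕ.^ n) (n !) {{ℕₚ.m^n≢0 2 n}} {{n ℕₚ.!≢0}}
    r = recip (2 ℕ.^ n ℕ.* n !) {{ne}}

  D≈Pf : ∀ m → D (2 ℕ.* m) n d ≈
    Pf m n (λ i → ∏ {m} (λ s → ι (idx (lookup i (even s)) ℤ.- idx (lookup i (odd s))))
                  * d (+ ((2 ℕ.* n ℕ.+ 1) ℕ.* m) ℤ.- ∑idx i))
  D≈Pf m = trans (D-𝐕 (2 ℕ.* m)) (trans (*-congˡ (powers .at weight-respects)) (sym (Pf-𝐏 m)))
    where
    a = 𝐕 ascending
    b = 𝐕 descending
    powers : (a EExp.^ (2 ℕ.* m) ⊛ b EExp.^ (2 ℕ.* m)) ≋ 𝐏 (𝔈 n) EExp.^ m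
    powers = E.trans (E.*-cong (E.sym (EExp.^-assocʳ a 2 m)) (E.sym (EExp.^-assocʳ b 2 m)))
      (E.trans (E.sym (EExp.^-distrib-* (a EExp.^ 2) (b EExp.^ 2) m)) (EExp.^-congˡ m (E.sym 𝐏-𝔈)))

  D≈pf : D 2 n d ≈ pf n (λ i j → ι (idx j ℤ.- idx i) * d (+ (2 ℕ.* n ℕ.+ 1) ℤ.- idx i ℤ.- idx j))
  D≈pf = trans (D-𝐕 2) (sym pf-𝐏)

theorem4p2 : ∀ {c ℓ a b} (𝕂 : Scalars c ℓ) (𝕋 : L¹-Structure 𝕂 a b) →
  let open Scalars 𝕂
      open Hyper 𝕂
      open L¹-Structure 𝕋
  in
  (m n : ℕ) .{{_ : NonZero m}} .{{_ : NonZero n}} (f : L¹) →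
  let d = fourier f in
  ( D (2 ℕ.* m) n d
    ≈ Pf m n (λ i →
        ∏ {m} (λ s → ι (idx (lookup i (even s)) ℤ.- idx (lookup i (odd s))))
        * d (+ ((2 ℕ.* n ℕ.+ 1) ℕ.* m) ℤ.- ∑idx i)) )
  ×
  ( D 2 n d
    ≈ pf n (λ i j →
        ι (idx j ℤ.- idx i) * d (+ (2 ℕ.* n ℕ.+ 1) ℤ.- idx i ℤ.- idx j)) )
theorem4p2 𝕂 𝕋 m n f = D≈Pf m , D≈pf
  where open Toeplitz 𝕂 n (L¹-Structure.fourier 𝕋 f)
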